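{- Let $\mathbb{A}$ be a symmetric strict monoidal category and let $\mathcal{C}(\mathbb{A})$ be its free cornering. Then there is an isomorphism of categories $\mathbf{V}\,\mathcal{C}(\mathbb{A}) \cong \mathbb{A}$, where $\mathbf{V}\,\mathcal{C}(\mathbb{A})$ is the category of vertical cells of $\mathcal{C}(\mathbb{A})$.
   Context: Single-object double categories. A single-object double category $\mathbb{D}$ consists of a monoid $(\mathbb{D}_H,\otimes,I)$ of horizontal edges, a monoid $(\mathbb{D}_V,\otimes,I)$ of vertical edges, and cells $\alpha$, each with a top and a bottom boundary in $\mathbb{D}_H$ and a left and a right boundary in $\mathbb{D}_V$. If the right boundary of $\alpha$ equals the left boundary of $\beta$ there is a horizontal composite $\alpha\vert\beta$ (top/bottom boundaries are multiplied in the order $\alpha,\beta$; left boundary that of $\alpha$, right boundary that of $\beta$). If the bottom boundary of $\alpha$ equals the top boundary of $\beta$ there is a vertical composite $\frac{\alpha}{\beta}$ (left/right boundaries multiplied in the order $\alpha,\beta$; top that of $\alpha$, bottom that of $\beta$). Both compositions are associative and unital, with identity cells $1_A$ for $A\in\mathbb{D}_H$ (top $=$ bottom $=A$, left $=$ right $=I$; identities for vertical composition) and $1_X$ for $X\in\mathbb{D}_V$ (left $=$ right $=X$, top $=$ bottom $=I$; identities for horizontal composition), with $1_A\vert 1_B=1_{A\otimes B}$, $\frac{1_X}{1_Y}=1_{X\otimes Y}$, the two identity cells on $I$ coincide, and the interchange law $\frac{\alpha}{\beta}\big\vert\frac{\gamma}{\delta}=\frac{\alpha\vert\gamma}{\beta\vert\delta}$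 holds. Vertical cells. $\mathbf{V}\mathbb{D}$ is the strict monoidal category with object set $\mathbb{D}_H$, whose morphisms $A\to B$ are cells with top $A$, bottom $B$ and left and right boundary $I$; composition is vertical composition and tensor product is horizontal composition. Free cornering. For a symmetric strict monoidal category $\mathbb{A}$ (with object set $\mathbb{A}_0$), $\mathcal{C}(\mathbb{A})$ is the free single-object double category determined by: horizontal edge monoid $(\mathbb{A}_0,\otimes,I)$; vertical edge monoid the free monoid $\mathbb{A}^{\circ\bullet}=(\mathbb{A}_0\times\{\circ,\bullet\})^*$, with generators written $A^\circ$, $A^\bullet$, product written $\otimes$ and unit $I$; generating cells, for each $A\in\mathbb{A}_0$, the corners (boundaries not mentioned are $I$) - $s^\circ_A$: top $A$, right $A^\circ$; $\quad r^\circ_A$: left $A^\circ$, bottom $A$; - $s^\bullet_A$: top $A$, left $A^\bullet$; $\quad r^\bullet_A$: right $A^\bullet$, bottom $A$; and, for each morphism $f:A\to B$ of $\mathbb{A}$, a cell $\ulcorner f\urcorner$ with top $A$, bottom $B$; subject to the yanking equations $s^\circ_A\vert r^\circ_A=1_A$, $\frac{r^\circ_A}{s^\circ_A}=1_{A^\circ}$, $r^\bullet_A\vert s^\bullet_A=1_A$, $\frac{r^\bullet_A}{s^\bullet_A}=1_{A^\bullet}$, and the equations $\frac{\ulcorner f\urcorner}{\ulcorner g\urcorner}=\ulcorner f;g\urcorner$ (for composable $f,g$; $f;g$ is "first $f$ then $g$"), $\ulcorner 1_A\urcorner=1_A$, $\ulcorner f\urcorner\vert\ulcorner g\urcorner=\ulcorner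 f\otimes g\urcorner$. Thus cells are formed from generators and identities by the two compositions, modulo the double category axioms and these equations. -}

module Defs where

open import Level using (Level; _⊔_; suc)
open import Algebra.Structures using (IsMonoid)
open import Data.List.Base using (List; []; [_]; _++_)
open import Data.List.Properties using (++-isMonoid; ++-assoc; ++-identityʳ)
open import Data.Product.Base using (Σ-syntax; _×_; _,_)
open import Relation.Binary.PropositionalEquality
  using (_≡_; refl; sym; trans; cong₂; subst; subst₂)
open import Relation.Binary.Structures using (IsEquivalence)

------------------------------------------------------------------------
-- Categories.  Hom-sets are setoids; objects are compared by _≡_, so that
-- strict monoidal structure and isomorphism of categories make sense.
-- (This module is checked with axiom K, so equality of objects is proof
-- irrelevant.)

record Category (o ℓ e : Level) : Set (suc (o ⊔ ℓ ⊔ e)) where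
  infix  4 _≈_ _≋_
  infixr 9 _⨾_
  field
    Obj : Set o
    Hom : Obj → Obj → Set ℓ
    _≈_ : ∀ {A B} → Hom A B → Hom A B → Set e
    id  : ∀ A → Hom A A
    -- Diagrammatic order: first f, then g.
    _⨾_ : ∀ {A B C} → Hom A B → Hom B C → Hom A C

    ≈-isEquivalence : ∀ {A B} → IsEquivalence (_≈_ {A} {B})
    ⨾-cong    : ∀ {A B C} {f f′ : Hom A B} {g g′ : Hom B C} →
                f ≈ f′ → g ≈ g′ → f ⨾ g ≈ f′ ⨾ g′
    assoc     : ∀ {A B C D} (f : Hom A B) (g : Hom B C) (h : Hom C D) →
                (f ⨾ g) ⨾ h ≈ f ⨾ (g ⨾ h)
    identityˡ : ∀ {A B} (f : Hom A B) → id A ⨾ f ≈ f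
    identityʳ : ∀ {A B} (f : Hom A B) → f ⨾ id B ≈ f

  -- Equality of morphisms whose domains and codomains are only
  -- propositionally equal.
  _≋_ : ∀ {A B A′ B′} → Hom A B → Hom A′ B′ → Set (o ⊔ e)
  _≋_ {A} {B} {A′} {B′} f g =
    Σ[ p ∈ A ≡ A′ ] Σ[ q ∈ B ≡ B′ ] subst₂ Hom p q f ≈ g

  coe : ∀ {A B} → A ≡ B → Hom A B
  coe {A} p = subst (Hom A) p (id A)

record Functor {o ℓ e o′ ℓ′ e′ : Level}
               (C : Category o ℓ e) (D : Category o′ ℓ′ e′) :
               Set (o ⊔ ℓ ⊔ e ⊔ o′ ⊔ ℓ′ ⊔ e′) where
  private
    module C = Category C
    module D = Category D
  field
    F₀ : C.Obj → D.Obj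
    F₁ : ∀ {A B} → C.Hom A B → D.Hom (F₀ A) (F₀ B)

    F-cong       : ∀ {A B} {f g : C.Hom A B} → f C.≈ g → F₁ f D.≈ F₁ g
    identity     : ∀ A → F₁ (C.id A) D.≈ D.id (F₀ A)
    homomorphism : ∀ {A B X} (f : C.Hom A B) (g : C.Hom B X) →
                   F₁ (f C.⨾ g) D.≈ F₁ f D.⨾ F₁ g

idF : ∀ {o ℓ e} (C : Category o ℓ e) → Functor C C
idF C = record
  { F₀ = λ A → A
  ; F₁ = λ f → f
  ; F-cong = λ p → p
  ; identity = λ _ → IsEquivalence.refl ≈-isEquivalence
  ; homomorphism = λ _ _ → IsEquivalence.refl ≈-isEquivalence
  } where open Category C

infixr 9 _∘F_
_∘F_ : ∀ {o ℓ e o′ ℓ′ e′ o″ ℓ″ e″} {C : Category o ℓ e}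
         {D : Category o′ ℓ′ e′} {E : Category o″ ℓ″ e″} →
       Functor D E → Functor C D → Functor C E
_∘F_ {E = E} G F = record
  { F₀ = λ A → G.F₀ (F.F₀ A)
  ; F₁ = λ f → G.F₁ (F.F₁ f)
  ; F-cong = λ p → G.F-cong (F.F-cong p)
  ; identity = λ A → E.trans (G.F-cong (F.identity A)) (G.identity (F.F₀ A))
  ; homomorphism = λ f g →
      E.trans (G.F-cong (F.homomorphism f g)) (G.homomorphism (F.F₁ f) (F.F₁ g))
  } where
    module F = Functor F
    module G = Functor G
    module E {A B} = IsEquivalence (Category.≈-isEquivalence E {A} {B})

-- Strict equality of functors.  The equality of objects is stated separately
-- because _≋_ only yields it at objects that occur as endpoints.
record _≡F_ {o ℓ e o′ ℓ′ e′ : Level} {C : Category o ℓ e} {D : Category o′ ℓ′ e′}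
            (F G : Functor C D) : Set (o ⊔ ℓ ⊔ o′ ⊔ e′) where
  private
    module C = Category C
    module D = Category D
    module F = Functor F
    module G = Functor G
  field
    eq₀ : ∀ A → F.F₀ A ≡ G.F₀ A
    eq₁ : ∀ {A B} (f : C.Hom A B) → F.F₁ f D.≋ G.F₁ f

record IsomorphismOfCategories
         {o ℓ e o′ ℓ′ e′ : Level}
         (C : Category o ℓ e) (D : Category o′ ℓ′ e′) :
         Set (o ⊔ ℓ ⊔ e ⊔ o′ ⊔ ℓ′ ⊔ e′) where
  field
    to      : Functor C D
    from    : Functor D C
    from∘to : (from ∘F to) ≡F idF C
    to∘from : (to ∘F from) ≡F idF D

------------------------------------------------------------------------
-- Strict monoidal categories

record StrictMonoidalCategory (o ℓ e : Level) : Set (suc (o ⊔ ℓ ⊔ e)) where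
  infixr 10 _⊗₀_ _⊗₁_
  field
    category : Category o ℓ e
  open Category category public
  field
    _⊗₀_ : Obj → Obj → Obj
    unit : Obj
    ⊗₀-isMonoid : IsMonoid _≡_ _⊗₀_ unit

    _⊗₁_ : ∀ {A B C D} → Hom A B → Hom C D → Hom (A ⊗₀ C) (B ⊗₀ D)
    ⊗₁-cong : ∀ {A B C D} {f f′ : Hom A B} {g g′ : Hom C D} →
              f ≈ f′ → g ≈ g′ → f ⊗₁ g ≈ f′ ⊗₁ g′
    ⊗₁-id : ∀ A B → id A ⊗₁ id B ≈ id (A ⊗₀ B)
    ⊗₁-⨾  : ∀ {A B C A′ B′ C′}
            (f : Hom A B) (g : Hom B C) (f′ : Hom A′ B′) (g′ : Hom B′ C′) →
            (f ⨾ g) ⊗₁ (f′ ⨾ g′) ≈ (f ⊗₁ f′) ⨾ (g ⊗₁ g′)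

    ⊗₁-assoc : ∀ {A B C D E F} (f : Hom A B) (g : Hom C D) (h : Hom E F) →
               (f ⊗₁ g) ⊗₁ h ≋ f ⊗₁ (g ⊗₁ h)
    ⊗₁-identityˡ : ∀ {A B} (f : Hom A B) → id unit ⊗₁ f ≋ f
    ⊗₁-identityʳ : ∀ {A B} (f : Hom A B) → f ⊗₁ id unit ≋ f

  module ⊗₀ = IsMonoid ⊗₀-isMonoid

record SymmetricStrictMonoidalCategory (o ℓ e : Level) :
       Set (suc (o ⊔ ℓ ⊔ e)) where
  field
    strictMonoidalCategory : StrictMonoidalCategory o ℓ e
  open StrictMonoidalCategory strictMonoidalCategory public
  field
    σ : ∀ A B → Hom (A ⊗₀ B) (B ⊗₀ A)
    σ-natural : ∀ {A B C D} (f : Hom A B) (g : Hom C D) →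
                (f ⊗₁ g) ⨾ σ B D ≈ σ A C ⨾ (g ⊗₁ f)
    σ-involutive : ∀ A B → σ A B ⨾ σ B A ≈ id (A ⊗₀ B)
    -- The other hexagon and σ A unit ≋ id A follow from these axioms.
    σ-hexagon : ∀ A B C →
                σ A (B ⊗₀ C) ≋
                (σ A B ⊗₁ id C) ⨾ coe (⊗₀.assoc B A C) ⨾ (id B ⊗₁ σ A C)

------------------------------------------------------------------------
-- Single-object double categories

subst₄ : ∀ {h v c} {H : Set h} {V : Set v} (P : H → H → V → V → Set c)
         {A A′ B B′ X X′ Y Y′} → A ≡ A′ → B ≡ B′ → X ≡ X′ → Y ≡ Y′ →
         P A B X Y → P A′ B′ X′ Y′
subst₄ P refl refl refl refl α = α

record SingleObjectDoubleCategory (h v c e : Level) :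
       Set (suc (h ⊔ v ⊔ c ⊔ e)) where
  infix  4 _≈_ _≋_
  infixl 8 _∣_
  infixl 9 _/_
  field
    H : Set h
    _⊗ᴴ_ : H → H → H
    Iᴴ : H
    H-isMonoid : IsMonoid _≡_ _⊗ᴴ_ Iᴴ

    V : Set v
    _⊗ⱽ_ : V → V → V
    Iⱽ : V
    V-isMonoid : IsMonoid _≡_ _⊗ⱽ_ Iⱽ

    -- Order of the boundaries: top, bottom, left, right.
    Cell : H → H → V → V → Set c
    _≈_ : ∀ {A B X Y} → Cell A B X Y → Cell A B X Y → Set e
    ≈-isEquivalence : ∀ {A B X Y} → IsEquivalence (_≈_ {A} {B} {X} {Y})

  -- Equality of cells whose boundaries are only propositionally equal.
  _≋_ : ∀ {A A′ B B′ X X′ Y Y′} →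
        Cell A B X Y → Cell A′ B′ X′ Y′ → Set (h ⊔ v ⊔ e)
  _≋_ {A} {A′} {B} {B′} {X} {X′} {Y} {Y′} α β =
    Σ[ p ∈ A ≡ A′ ] Σ[ q ∈ B ≡ B′ ] Σ[ r ∈ X ≡ X′ ] Σ[ s ∈ Y ≡ Y′ ]
      subst₄ Cell p q r s α ≈ β

  field
    -- α ∣ β: α to the left of β.  α / β: α on top of β.
    _∣_ : ∀ {A B C D X Y Z} →
          Cell A B X Y → Cell C D Y Z → Cell (A ⊗ᴴ C) (B ⊗ᴴ D) X Z
    _/_ : ∀ {A B C X X′ Y Y′} →
          Cell A B X Y → Cell B C X′ Y′ → Cell A C (X ⊗ⱽ X′) (Y ⊗ⱽ Y′)
    idᴴ : ∀ A → Cell A A Iⱽ Iⱽ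
    idⱽ : ∀ X → Cell Iᴴ Iᴴ X X

    ∣-cong : ∀ {A B C D X Y Z} {α α′ : Cell A B X Y} {β β′ : Cell C D Y Z} →
             α ≈ α′ → β ≈ β′ → α ∣ β ≈ α′ ∣ β′
    /-cong : ∀ {A B C X X′ Y Y′} {α α′ : Cell A B X Y} {β β′ : Cell B C X′ Y′} →
             α ≈ α′ → β ≈ β′ → α / β ≈ α′ / β′

    ∣-assoc : ∀ {A B C D E F W X Y Z}
              (α : Cell A B W X) (β : Cell C D X Y) (γ : Cell E F Y Z) →
              (α ∣ β) ∣ γ ≋ α ∣ (β ∣ γ)
    ∣-identityˡ : ∀ {A B X Y} (α : Cell A B X Y) → idⱽ X ∣ α ≋ α
    ∣-identityʳ : ∀ {A B X Y} (α : Cell A B X Y) → α ∣ idⱽ Y ≋ α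

    /-assoc : ∀ {A B C D X Y X′ Y′ X″ Y″}
              (α : Cell A B X Y) (β : Cell B C X′ Y′) (γ : Cell C D X″ Y″) →
              (α / β) / γ ≋ α / (β / γ)
    /-identityˡ : ∀ {A B X Y} (α : Cell A B X Y) → idᴴ A / α ≋ α
    /-identityʳ : ∀ {A B X Y} (α : Cell A B X Y) → α / idᴴ B ≋ α

    idᴴ-⊗ : ∀ A B → idᴴ A ∣ idᴴ B ≈ idᴴ (A ⊗ᴴ B)
    idⱽ-⊗ : ∀ X Y → idⱽ X / idⱽ Y ≈ idⱽ (X ⊗ⱽ Y)
    idᴴ≈idⱽ : idᴴ Iᴴ ≈ idⱽ Iⱽ

    interchange : ∀ {A B C D E F X X′ Y Y′ Z Z′}
                  (α : Cell A B X Y) (β : Cell B C X′ Y′)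
                  (γ : Cell D E Y Z) (δ : Cell E F Y′ Z′) →
                  (α / β) ∣ (γ / δ) ≈ (α ∣ γ) / (β ∣ δ)

  module H = IsMonoid H-isMonoid
  module V = IsMonoid V-isMonoid
  module ≈ {A B X Y} = IsEquivalence (≈-isEquivalence {A} {B} {X} {Y})

  ≈⇒≋ : ∀ {A B X Y} {α β : Cell A B X Y} → α ≈ β → α ≋ β
  ≈⇒≋ p = refl , refl , refl , refl , p

  ≋⇒≈ : ∀ {A B X Y} {α β : Cell A B X Y} → α ≋ β → α ≈ β
  ≋⇒≈ (refl , refl , refl , refl , p) = p

  ≋-refl : ∀ {A B X Y} {α : Cell A B X Y} → α ≋ α
  ≋-refl = ≈⇒≋ ≈.refl

  ≋-sym : ∀ {A A′ B B′ X X′ Y Y′} {α : Cell A B X Y} {β : Cell A′ B′ X′ Y′} →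
          α ≋ β → β ≋ α
  ≋-sym (refl , refl , refl , refl , p) = ≈⇒≋ (≈.sym p)

  ≋-trans : ∀ {A A′ A″ B B′ B″ X X′ X″ Y Y′ Y″}
            {α : Cell A B X Y} {β : Cell A′ B′ X′ Y′} {γ : Cell A″ B″ X″ Y″} →
            α ≋ β → β ≋ γ → α ≋ γ
  ≋-trans (refl , refl , refl , refl , p) (refl , refl , refl , refl , q) =
    ≈⇒≋ (≈.trans p q)

  subst₄-≋ : ∀ {A A′ B B′ X X′ Y Y′}
           (p : A ≡ A′) (q : B ≡ B′) (r : X ≡ X′) (s : Y ≡ Y′)
           (α : Cell A B X Y) → subst₄ Cell p q r s α ≋ α
  subst₄-≋ refl refl refl refl α = ≋-refl

  ∣-cong-≋ : ∀ {A B C D X Y Z A′ B′ C′ D′ X′ Y′ Z′}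
             {α : Cell A B X Y} {α′ : Cell A′ B′ X′ Y′}
             {β : Cell C D Y Z} {β′ : Cell C′ D′ Y′ Z′} →
             α ≋ α′ → β ≋ β′ → α ∣ β ≋ α′ ∣ β′
  ∣-cong-≋ (refl , refl , refl , refl , p) (refl , refl , refl , refl , q) =
    ≈⇒≋ (∣-cong p q)

  /-cong-≋ : ∀ {A B C X Y Z W A′ B′ C′ X′ Y′ Z′ W′}
             {α : Cell A B X Y} {α′ : Cell A′ B′ X′ Y′}
             {β : Cell B C Z W} {β′ : Cell B′ C′ Z′ W′} →
             α ≋ α′ → β ≋ β′ → α / β ≋ α′ / β′
  /-cong-≋ (refl , refl , refl , refl , p) (refl , refl , refl , refl , q) =
    ≈⇒≋ (/-cong p q)

------------------------------------------------------------------------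
-- The strict monoidal category of vertical cells

module _ {h v c e : Level} (𝔻 : SingleObjectDoubleCategory h v c e) where
  open SingleObjectDoubleCategory 𝔻

  private
    -- The side boundaries of α / β are Iⱽ ⊗ⱽ Iⱽ, whence the transport.
    infixr 9 _⨾_
    _⨾_ : ∀ {A B C} → Cell A B Iⱽ Iⱽ → Cell B C Iⱽ Iⱽ → Cell A C Iⱽ Iⱽ
    α ⨾ β = subst₄ Cell refl refl (V.identityˡ Iⱽ) (V.identityˡ Iⱽ) (α / β)

    ⨾≋/ : ∀ {A B C} (α : Cell A B Iⱽ Iⱽ) (β : Cell B C Iⱽ Iⱽ) → α ⨾ β ≋ α / β
    ⨾≋/ α β = subst₄-≋ _ _ _ _ (α / β)

    verticalCategory : Category h c e
    verticalCategory = record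
      { Obj = H
      ; Hom = λ A B → Cell A B Iⱽ Iⱽ
      ; _≈_ = _≈_
      ; id  = idᴴ
      ; _⨾_ = _⨾_
      ; ≈-isEquivalence = ≈-isEquivalence
      ; ⨾-cong = λ p q → ≋⇒≈
          (≋-trans (⨾≋/ _ _) (≋-trans (≈⇒≋ (/-cong p q)) (≋-sym (⨾≋/ _ _))))
      ; assoc = λ α β γ → ≋⇒≈
          (≋-trans (⨾≋/ _ γ) (≋-trans (/-cong-≋ (⨾≋/ α β) ≋-refl)
          (≋-trans (/-assoc α β γ) (≋-sym
          (≋-trans (⨾≋/ α _) (/-cong-≋ ≋-refl (⨾≋/ β γ)))))))
      ; identityˡ = λ α → ≋⇒≈ (≋-trans (⨾≋/ _ α) (/-identityˡ α))
      ; identityʳ = λ α → ≋⇒≈ (≋-trans (⨾≋/ α _) (/-identityʳ α))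
      }

    ≋⇒≋ⱽ : ∀ {A B A′ B′} {α : Cell A B Iⱽ Iⱽ} {β : Cell A′ B′ Iⱽ Iⱽ} →
           α ≋ β → Category._≋_ verticalCategory α β
    ≋⇒≋ⱽ (refl , refl , refl , refl , p) = refl , refl , p

  𝐕 : StrictMonoidalCategory h c e
  𝐕 = record
    { category = verticalCategory
    ; _⊗₀_ = _⊗ᴴ_
    ; unit = Iᴴ
    ; ⊗₀-isMonoid = H-isMonoid
    ; _⊗₁_ = _∣_
    ; ⊗₁-cong = ∣-cong
    ; ⊗₁-id = idᴴ-⊗
    ; ⊗₁-⨾ = λ α β γ δ → ≋⇒≈
        (≋-trans (∣-cong-≋ (⨾≋/ α β) (⨾≋/ γ δ))
        (≋-trans (≈⇒≋ (interchange α β γ δ)) (≋-sym (⨾≋/ _ _))))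
    ; ⊗₁-assoc = λ α β γ → ≋⇒≋ⱽ (∣-assoc α β γ)
    ; ⊗₁-identityˡ = λ α → ≋⇒≋ⱽ
        (≋-trans (∣-cong-≋ (≈⇒≋ idᴴ≈idⱽ) ≋-refl) (∣-identityˡ α))
    ; ⊗₁-identityʳ = λ α → ≋⇒≋ⱽ
        (≋-trans (∣-cong-≋ ≋-refl (≈⇒≋ idᴴ≈idⱽ)) (∣-identityʳ α))
    }

------------------------------------------------------------------------
-- The free cornering

data Polarity : Set where
  ○ ● : Polarity

module FreeCornering {o ℓ e : Level} (𝔸 : SymmetricStrictMonoidalCategory o ℓ e) where
  open SymmetricStrictMonoidalCategory 𝔸

  Exchange : Set o
  Exchange = List (Obj × Polarity)

  infixl 30 _° _•
  _° _• : Obj → Exchange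
  A ° = [ A , ○ ]
  A • = [ A , ● ]

  infixl 8 _∣_
  infixl 9 _/_
  data Cell : (top bottom : Obj) (left right : Exchange) → Set (o ⊔ ℓ) where
    _∣_ : ∀ {A B C D X Y Z} →
          Cell A B X Y → Cell C D Y Z → Cell (A ⊗₀ C) (B ⊗₀ D) X Z
    _/_ : ∀ {A B C X X′ Y Y′} →
          Cell A B X Y → Cell B C X′ Y′ → Cell A C (X ++ X′) (Y ++ Y′)
    idᴴ : ∀ A → Cell A A [] []
    idⱽ : ∀ X → Cell unit unit X X

    s° : ∀ A → Cell A unit [] (A °)
    r° : ∀ A → Cell unit A (A °) []
    s• : ∀ A → Cell A unit (A •) []
    r• : ∀ A → Cell unit A [] (A •)

    ⌜_⌝ : ∀ {A B} → Hom A B → Cell A B [] []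

  -- The least congruence containing the axioms of a double category and the
  -- defining equations.  It is heterogeneous because the two sides of an
  -- equation can have boundaries that are only propositionally equal.
  infix 4 _∼_
  data _∼_ : ∀ {A B X Y A′ B′ X′ Y′} →
             Cell A B X Y → Cell A′ B′ X′ Y′ → Set (o ⊔ ℓ ⊔ e) where
    ∼-refl  : ∀ {A B X Y} {α : Cell A B X Y} → α ∼ α
    ∼-sym   : ∀ {A B X Y A′ B′ X′ Y′} {α : Cell A B X Y} {β : Cell A′ B′ X′ Y′} →
              α ∼ β → β ∼ α
    ∼-trans : ∀ {A B X Y A′ B′ X′ Y′ A″ B″ X″ Y″}
              {α : Cell A B X Y} {β : Cell A′ B′ X′ Y′} {γ : Cell A″ B″ X″ Y″} →
              α ∼ β → β ∼ γ → α ∼ γ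
    ∣-cong  : ∀ {A B C D X Y Z A′ B′ C′ D′ X′ Y′ Z′}
              {α : Cell A B X Y} {α′ : Cell A′ B′ X′ Y′}
              {β : Cell C D Y Z} {β′ : Cell C′ D′ Y′ Z′} →
              α ∼ α′ → β ∼ β′ → α ∣ β ∼ α′ ∣ β′
    /-cong  : ∀ {A B C X Y Z W A′ B′ C′ X′ Y′ Z′ W′}
              {α : Cell A B X Y} {α′ : Cell A′ B′ X′ Y′}
              {β : Cell B C Z W} {β′ : Cell B′ C′ Z′ W′} →
              α ∼ α′ → β ∼ β′ → α / β ∼ α′ / β′

    ∣-assoc : ∀ {A B C D E F W X Y Z}
              (α : Cell A B W X) (β : Cell C D X Y) (γ : Cell E F Y Z) →
              (α ∣ β) ∣ γ ∼ α ∣ (β ∣ γ)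
    ∣-identityˡ : ∀ {A B X Y} (α : Cell A B X Y) → idⱽ X ∣ α ∼ α
    ∣-identityʳ : ∀ {A B X Y} (α : Cell A B X Y) → α ∣ idⱽ Y ∼ α
    /-assoc : ∀ {A B C D X Y X′ Y′ X″ Y″}
              (α : Cell A B X Y) (β : Cell B C X′ Y′) (γ : Cell C D X″ Y″) →
              (α / β) / γ ∼ α / (β / γ)
    /-identityˡ : ∀ {A B X Y} (α : Cell A B X Y) → idᴴ A / α ∼ α
    /-identityʳ : ∀ {A B X Y} (α : Cell A B X Y) → α / idᴴ B ∼ α
    idᴴ-⊗ : ∀ A B → idᴴ A ∣ idᴴ B ∼ idᴴ (A ⊗₀ B)
    idⱽ-⊗ : ∀ X Y → idⱽ X / idⱽ Y ∼ idⱽ (X ++ Y)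
    idᴴ∼idⱽ : idᴴ unit ∼ idⱽ []
    interchange : ∀ {A B C D E F X X′ Y Y′ Z Z′}
                  (α : Cell A B X Y) (β : Cell B C X′ Y′)
                  (γ : Cell D E Y Z) (δ : Cell E F Y′ Z′) →
                  (α / β) ∣ (γ / δ) ∼ (α ∣ γ) / (β ∣ δ)

    yank°-∣ : ∀ A → s° A ∣ r° A ∼ idᴴ A
    yank°-/ : ∀ A → r° A / s° A ∼ idⱽ (A °)
    yank•-∣ : ∀ A → r• A ∣ s• A ∼ idᴴ A
    yank•-/ : ∀ A → r• A / s• A ∼ idⱽ (A •)

    ⌜⌝-cong : ∀ {A B} {f g : Hom A B} → f ≈ g → ⌜ f ⌝ ∼ ⌜ g ⌝
    ⌜⌝-⨾  : ∀ {A B C} (f : Hom A B) (g : Hom B C) → ⌜ f ⌝ / ⌜ g ⌝ ∼ ⌜ f ⨾ g ⌝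
    ⌜⌝-id : ∀ A → ⌜ id A ⌝ ∼ idᴴ A
    ⌜⌝-⊗  : ∀ {A B C D} (f : Hom A B) (g : Hom C D) →
            ⌜ f ⌝ ∣ ⌜ g ⌝ ∼ ⌜ f ⊗₁ g ⌝

  ∼⇒boundaries : ∀ {A B X Y A′ B′ X′ Y′}
                 {α : Cell A B X Y} {β : Cell A′ B′ X′ Y′} →
                 α ∼ β → A ≡ A′ × B ≡ B′ × X ≡ X′ × Y ≡ Y′
  ∼⇒boundaries ∼-refl = refl , refl , refl , refl
  ∼⇒boundaries (∼-sym p) with ∼⇒boundaries p
  ... | a , b , x , y = sym a , sym b , sym x , sym y
  ∼⇒boundaries (∼-trans p q) with ∼⇒boundaries p | ∼⇒boundaries q
  ... | a , b , x , y | a′ , b′ , x′ , y′ =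
    trans a a′ , trans b b′ , trans x x′ , trans y y′
  ∼⇒boundaries (∣-cong p q) with ∼⇒boundaries p | ∼⇒boundaries q
  ... | a , b , x , _ | c , d , _ , z = cong₂ _⊗₀_ a c , cong₂ _⊗₀_ b d , x , z
  ∼⇒boundaries (/-cong p q) with ∼⇒boundaries p | ∼⇒boundaries q
  ... | a , _ , x , y | _ , c , z , w = a , c , cong₂ _++_ x z , cong₂ _++_ y w
  ∼⇒boundaries (∣-assoc _ _ _) = ⊗₀.assoc _ _ _ , ⊗₀.assoc _ _ _ , refl , refl
  ∼⇒boundaries (∣-identityˡ _) = ⊗₀.identityˡ _ , ⊗₀.identityˡ _ , refl , refl
  ∼⇒boundaries (∣-identityʳ _) = ⊗₀.identityʳ _ , ⊗₀.identityʳ _ , refl , refl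
  ∼⇒boundaries (/-assoc {X = X} {Y = Y} _ _ _) =
    refl , refl , ++-assoc X _ _ , ++-assoc Y _ _
  ∼⇒boundaries (/-identityˡ _) = refl , refl , refl , refl
  ∼⇒boundaries (/-identityʳ _) = refl , refl , ++-identityʳ _ , ++-identityʳ _
  ∼⇒boundaries (idᴴ-⊗ _ _) = refl , refl , refl , refl
  ∼⇒boundaries (idⱽ-⊗ _ _) = refl , refl , refl , refl
  ∼⇒boundaries idᴴ∼idⱽ = refl , refl , refl , refl
  ∼⇒boundaries (interchange _ _ _ _) = refl , refl , refl , refl
  ∼⇒boundaries (yank°-∣ A) = ⊗₀.identityʳ A , ⊗₀.identityˡ A , refl , refl
  ∼⇒boundaries (yank°-/ _) = refl , refl , refl , refl
  ∼⇒boundaries (yank•-∣ A) = ⊗₀.identityˡ A , ⊗₀.identityʳ A , refl , refl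
  ∼⇒boundaries (yank•-/ _) = refl , refl , refl , refl
  ∼⇒boundaries (⌜⌝-cong _) = refl , refl , refl , refl
  ∼⇒boundaries (⌜⌝-⨾ _ _) = refl , refl , refl , refl
  ∼⇒boundaries (⌜⌝-id _) = refl , refl , refl , refl
  ∼⇒boundaries (⌜⌝-⊗ _ _) = refl , refl , refl , refl

  ∼⇒≋ : ∀ {A A′ B B′ X X′ Y Y′} {α : Cell A B X Y} {β : Cell A′ B′ X′ Y′} →
        α ∼ β →
        Σ[ p ∈ A ≡ A′ ] Σ[ q ∈ B ≡ B′ ] Σ[ r ∈ X ≡ X′ ] Σ[ s ∈ Y ≡ Y′ ]
          subst₄ Cell p q r s α ∼ β
  ∼⇒≋ t with ∼⇒boundaries t
  ... | refl , refl , refl , refl = refl , refl , refl , refl , t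

  𝒞 : SingleObjectDoubleCategory o o (o ⊔ ℓ) (o ⊔ ℓ ⊔ e)
  𝒞 = record
    { H = Obj
    ; _⊗ᴴ_ = _⊗₀_
    ; Iᴴ = unit
    ; H-isMonoid = ⊗₀-isMonoid
    ; V = Exchange
    ; _⊗ⱽ_ = _++_
    ; Iⱽ = []
    ; V-isMonoid = ++-isMonoid
    ; Cell = Cell
    ; _≈_ = _∼_
    ; ≈-isEquivalence = record { refl = ∼-refl ; sym = ∼-sym ; trans = ∼-trans }
    ; _∣_ = _∣_
    ; _/_ = _/_
    ; idᴴ = idᴴ
    ; idⱽ = idⱽ
    ; ∣-cong = ∣-cong
    ; /-cong = /-cong
    ; ∣-assoc = λ α β γ → ∼⇒≋ (∣-assoc α β γ)
    ; ∣-identityˡ = λ α → ∼⇒≋ (∣-identityˡ α)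
    ; ∣-identityʳ = λ α → ∼⇒≋ (∣-identityʳ α)
    ; /-assoc = λ α β γ → ∼⇒≋ (/-assoc α β γ)
    ; /-identityˡ = λ α → ∼⇒≋ (/-identityˡ α)
    ; /-identityʳ = λ α → ∼⇒≋ (/-identityʳ α)
    ; idᴴ-⊗ = idᴴ-⊗
    ; idⱽ-⊗ = idⱽ-⊗
    ; idᴴ≈idⱽ = idᴴ∼idⱽ
    ; interchange = interchange
    }

open FreeCornering public using (𝒞)

module Submission where

-- The functor f ↦ ⌜ f ⌝ is inverted by evaluating cells in a model.  A cell with left
-- boundary [] and right boundary X has a normal form that performs the sends and receives
-- of X in order with morphisms of 𝔸 in between; normal forms are unique up to sliding a
-- morphism past a send.  A cell α with left boundary X acts on normal forms as n ↦ n ∣ α,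
-- and this action can be computed by recursion on α and respects every equation of the free
-- cornering.  If α has trivial sides, acting on the identity of the unit yields a morphism
-- of 𝔸, and it yields f if α is ⌜ f ⌝.  Conversely, reading normal forms back as cells
-- carries the action to _∣ α, so α is equal to ⌜_⌝ of the morphism it evaluates to.

open import Level using (_⊔_)
open import Data.List.Base using (List; []; _∷_; _++_)
open import Data.Product.Base using (Σ-syntax; _×_; _,_)
open import Relation.Binary.Bundles using (Setoid)
open import Relation.Binary.Construct.Closure.Equivalence using (EqClosure; gmap; gfold)
import Relation.Binary.Construct.Closure.Equivalence as Closure
open import Relation.Binary.PropositionalEquality using (_≡_; refl; sym; subst₂)
open import Relation.Binary.Structures using (IsEquivalence)
import Relation.Binary.Reasoning.Setoid as SetoidReasoning
open import Defs

module CellNormalisation {o ℓ e} (𝔸 : SymmetricStrictMonoidalCategory o ℓ e) where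
  open SymmetricStrictMonoidalCategory 𝔸 renaming (id to 𝟙)
  open FreeCornering 𝔸 hiding (𝒞)

  module ≈ {A B} = IsEquivalence (≈-isEquivalence {A} {B})

  private variable
    A A′ B B′ C C′ D D′ E E′ F : Obj
    X X′ X″ Y Y′ Y″ Z Z′ : Exchange

  -- Heterogeneous equality of morphisms

  ≋-refl : {f : Hom A B} → f ≋ f
  ≋-refl = refl , refl , ≈.refl

  ≈⇒≋ : {f g : Hom A B} → f ≈ g → f ≋ g
  ≈⇒≋ p = refl , refl , p

  ≋⇒≈ : {f g : Hom A B} → f ≋ g → f ≈ g
  ≋⇒≈ (refl , refl , p) = p

  ≋-sym : {f : Hom A B} {g : Hom A′ B′} → f ≋ g → g ≋ f
  ≋-sym (refl , refl , p) = refl , refl , ≈.sym p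

  ≋-trans : {f : Hom A B} {g : Hom A′ B′} {h : Hom C D} → f ≋ g → g ≋ h → f ≋ h
  ≋-trans (refl , refl , p) (refl , refl , q) = refl , refl , ≈.trans p q

  ⨾-cong-≋ : {f : Hom A B} {g : Hom B C} {f′ : Hom A′ B′} {g′ : Hom B′ C′} →
             f ≋ f′ → g ≋ g′ → f ⨾ g ≋ f′ ⨾ g′
  ⨾-cong-≋ (refl , refl , p) (refl , refl , q) = ≈⇒≋ (⨾-cong p q)

  ⊗-cong-≋ : {f : Hom A B} {g : Hom C D} {f′ : Hom A′ B′} {g′ : Hom C′ D′} →
             f ≋ f′ → g ≋ g′ → f ⊗₁ g ≋ f′ ⊗₁ g′
  ⊗-cong-≋ (refl , refl , p) (refl , refl , q) = ≈⇒≋ (⊗₁-cong p q)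

  cast : A ≡ A′ → B ≡ B′ → Hom A B → Hom A′ B′
  cast = subst₂ Hom

  cast-≋ : (p : A ≡ A′) (q : B ≡ B′) (f : Hom A B) → cast p q f ≋ f
  cast-≋ refl refl f = ≋-refl

  ρ : A ≡ A ⊗₀ unit
  ρ = sym (⊗₀.identityʳ _)

  infixl 10 _⊗ʳ_
  _⊗ʳ_ : Hom A B → ∀ C → Hom (A ⊗₀ C) (B ⊗₀ C)
  f ⊗ʳ C = f ⊗₁ 𝟙 C

  ⊗ʳ-⨾ : (f : Hom A B) (g : Hom B C) → (f ⨾ g) ⊗ʳ D ≈ f ⊗ʳ D ⨾ g ⊗ʳ D
  ⊗ʳ-⨾ f g = ≈.trans (⊗₁-cong ≈.refl (≈.sym (identityˡ _))) (⊗₁-⨾ f g _ _)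

  ⊗ʳ-cong : {f g : Hom A B} → f ≈ g → f ⊗ʳ C ≈ g ⊗ʳ C
  ⊗ʳ-cong p = ⊗₁-cong p ≈.refl

  ⊗ʳ-⊗ʳ : (f : Hom A B) → f ⊗ʳ (C ⊗₀ D) ≋ (f ⊗ʳ C) ⊗ʳ D
  ⊗ʳ-⊗ʳ {C = C} {D} f = ≋-trans (≈⇒≋ (⊗₁-cong ≈.refl (≈.sym (⊗₁-id C D))))
                                 (≋-sym (⊗₁-assoc f (𝟙 C) (𝟙 D)))

  -- Behaviours

  -- A value of Behaviour C E X is a normal form of a cell with top C, bottom E, left
  -- boundary [] and right boundary X.
  data Behaviour : Obj → Obj → Exchange → Set (o ⊔ ℓ) where
    ret  : Hom C E → Behaviour C E []
    send : Hom C (D ⊗₀ A) → Behaviour D E X → Behaviour C E ((A , ○) ∷ X)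
    recv : Behaviour (C ⊗₀ A) E X → Behaviour C E ((A , ●) ∷ X)

  infixr 9 _·_
  -- The counterpart of placing `⌜ f ⌝` on top of a cell, as `⌈⌉-·` confirms. A send absorbs the
  -- morphism; at a receive it passes below, widened by the received object.
  _·_ : Hom C′ C → Behaviour C E X → Behaviour C′ E X
  f · ret g    = ret (f ⨾ g)
  f · send g n = send (f ⨾ g) n
  f · recv n   = recv (f ⊗ʳ _ · n)

  infixl 8 _⊲_
  _⊲_ : Behaviour C E X → Hom E E′ → Behaviour C E′ X
  ret f    ⊲ g = ret (f ⨾ g)
  send f n ⊲ g = send f (n ⊲ g)
  recv n   ⊲ g = recv (n ⊲ g)

  infixr 7 _⊙_
  _⊙_ : Behaviour C D X → Behaviour D E Y → Behaviour C E (X ++ Y)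
  ret f    ⊙ m = f · m
  send f n ⊙ m = send f (n ⊙ m)
  recv n   ⊙ m = recv (n ⊙ m)

  infix 4 _≈ᴮ_
  data _≈ᴮ_ : Behaviour C E X → Behaviour C E X → Set (o ⊔ ℓ ⊔ e) where
    reflᴮ  : {n : Behaviour C E X} → n ≈ᴮ n
    symᴮ   : {n m : Behaviour C E X} → n ≈ᴮ m → m ≈ᴮ n
    transᴮ : {n m k : Behaviour C E X} → n ≈ᴮ m → m ≈ᴮ k → n ≈ᴮ k
    ret    : {f g : Hom C E} → f ≈ g → ret f ≈ᴮ ret g
    send   : {f g : Hom C (D ⊗₀ A)} {n m : Behaviour D E X} →
             f ≈ g → n ≈ᴮ m → send f n ≈ᴮ send g m
    recv   : {n m : Behaviour (C ⊗₀ A) E X} → n ≈ᴮ m → recv {C} n ≈ᴮ recv m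
    -- The coend relation on the object D kept across a send.
    slide  : (f : Hom C (D ⊗₀ A)) (g : Hom D D′) (n : Behaviour D′ E X) →
             send (f ⨾ g ⊗ʳ A) n ≈ᴮ send f (g · n)

  ≈ᴮ-setoid : Obj → Obj → Exchange → Setoid (o ⊔ ℓ) (o ⊔ ℓ ⊔ e)
  ≈ᴮ-setoid C E X = record
    { Carrier = Behaviour C E X
    ; _≈_ = _≈ᴮ_
    ; isEquivalence = record { refl = reflᴮ ; sym = symᴮ ; trans = transᴮ }
    }

  module ≈ᴮ-Reasoning {C E X} = SetoidReasoning (≈ᴮ-setoid C E X)

  ·-congˡ : {f g : Hom C′ C} (n : Behaviour C E X) → f ≈ g → f · n ≈ᴮ g · n
  ·-congˡ (ret _)    p = ret (⨾-cong p ≈.refl)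
  ·-congˡ (send _ _) p = send (⨾-cong p ≈.refl) reflᴮ
  ·-congˡ (recv n)   p = recv (·-congˡ n (⊗ʳ-cong p))

  ·-congʳ : (f : Hom C′ C) {n m : Behaviour C E X} → n ≈ᴮ m → f · n ≈ᴮ f · m
  ·-congʳ f reflᴮ         = reflᴮ
  ·-congʳ f (symᴮ p)      = symᴮ (·-congʳ f p)
  ·-congʳ f (transᴮ p q)  = transᴮ (·-congʳ f p) (·-congʳ f q)
  ·-congʳ f (ret p)       = ret (⨾-cong ≈.refl p)
  ·-congʳ f (send p q)    = send (⨾-cong ≈.refl p) q
  ·-congʳ f (recv p)      = recv (·-congʳ _ p)
  ·-congʳ f (slide g h n) = transᴮ (send (≈.sym (assoc f g _)) reflᴮ) (slide (f ⨾ g) h n)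

  ·-id : (n : Behaviour C E X) → 𝟙 C · n ≈ᴮ n
  ·-id (ret f)    = ret (identityˡ f)
  ·-id (send f n) = send (identityˡ f) reflᴮ
  ·-id (recv n)   = recv (transᴮ (·-congˡ n (⊗₁-id _ _)) (·-id n))

  ·-⨾ : (f : Hom C D) (g : Hom D F) (n : Behaviour F E X) → (f ⨾ g) · n ≈ᴮ f · g · n
  ·-⨾ f g (ret h)    = ret (assoc f g h)
  ·-⨾ f g (send h n) = send (assoc f g h) reflᴮ
  ·-⨾ f g (recv n)   = recv (transᴮ (·-congˡ n (⊗ʳ-⨾ f g)) (·-⨾ _ _ n))

  ·-⊲ : (f : Hom C′ C) (n : Behaviour C E X) (g : Hom E E′) → f · (n ⊲ g) ≈ᴮ (f · n) ⊲ g
  ·-⊲ f (ret h)    g = ret (≈.sym (assoc f h g))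
  ·-⊲ f (send h n) g = reflᴮ
  ·-⊲ f (recv n)   g = recv (·-⊲ _ n g)

  ⊲-congʳ : (n : Behaviour C E X) {f g : Hom E E′} → f ≈ g → n ⊲ f ≈ᴮ n ⊲ g
  ⊲-congʳ (ret _)    p = ret (⨾-cong ≈.refl p)
  ⊲-congʳ (send _ n) p = send ≈.refl (⊲-congʳ n p)
  ⊲-congʳ (recv n)   p = recv (⊲-congʳ n p)

  ⊲-congˡ : {n m : Behaviour C E X} (g : Hom E E′) → n ≈ᴮ m → n ⊲ g ≈ᴮ m ⊲ g
  ⊲-congˡ g reflᴮ         = reflᴮ
  ⊲-congˡ g (symᴮ p)      = symᴮ (⊲-congˡ g p)
  ⊲-congˡ g (transᴮ p q)  = transᴮ (⊲-congˡ g p) (⊲-congˡ g q)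
  ⊲-congˡ g (ret p)       = ret (⨾-cong p ≈.refl)
  ⊲-congˡ g (send p q)    = send p (⊲-congˡ g q)
  ⊲-congˡ g (recv p)      = recv (⊲-congˡ g p)
  ⊲-congˡ g (slide f h n) = transᴮ (slide f h _) (send ≈.refl (·-⊲ h n g))

  ⊲-id : (n : Behaviour C E X) → n ⊲ 𝟙 E ≈ᴮ n
  ⊲-id (ret f)    = ret (identityʳ f)
  ⊲-id (send f n) = send ≈.refl (⊲-id n)
  ⊲-id (recv n)   = recv (⊲-id n)

  ·-⊙ : (f : Hom C′ C) (n : Behaviour C D X) (m : Behaviour D E Y) →
        f · (n ⊙ m) ≈ᴮ (f · n) ⊙ m
  ·-⊙ f (ret g)    m = symᴮ (·-⨾ f g m)
  ·-⊙ f (send g n) m = reflᴮ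
  ·-⊙ f (recv n)   m = recv (·-⊙ _ n m)

  ⊙-⊲ : (n : Behaviour C D X) (m : Behaviour D E Y) (g : Hom E E′) →
        (n ⊙ m) ⊲ g ≈ᴮ n ⊙ (m ⊲ g)
  ⊙-⊲ (ret f)    m g = symᴮ (·-⊲ f m g)
  ⊙-⊲ (send f n) m g = send ≈.refl (⊙-⊲ n m g)
  ⊙-⊲ (recv n)   m g = recv (⊙-⊲ n m g)

  -- A morphism at the joint can be counted with either half. This is what makes gluing insensitive
  -- to where a boundary was cut.
  ⊲-⊙ : (n : Behaviour C D X) (g : Hom D D′) (m : Behaviour D′ E Y) →
        (n ⊲ g) ⊙ m ≈ᴮ n ⊙ (g · m)
  ⊲-⊙ (ret f)    g m = ·-⨾ f g m
  ⊲-⊙ (send f n) g m = send ≈.refl (⊲-⊙ n g m)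
  ⊲-⊙ (recv n)   g m = recv (⊲-⊙ n g m)

  ⊙-congˡ : {n n′ : Behaviour C D X} (m : Behaviour D E Y) → n ≈ᴮ n′ → n ⊙ m ≈ᴮ n′ ⊙ m
  ⊙-congˡ m reflᴮ         = reflᴮ
  ⊙-congˡ m (symᴮ p)      = symᴮ (⊙-congˡ m p)
  ⊙-congˡ m (transᴮ p q)  = transᴮ (⊙-congˡ m p) (⊙-congˡ m q)
  ⊙-congˡ m (ret p)       = ·-congˡ m p
  ⊙-congˡ m (send p q)    = send p (⊙-congˡ m q)
  ⊙-congˡ m (recv p)      = recv (⊙-congˡ m p)
  ⊙-congˡ m (slide f g n) = transᴮ (slide f g _) (send ≈.refl (·-⊙ g n m))

  ⊙-congʳ : (n : Behaviour C D X) {m m′ : Behaviour D E Y} → m ≈ᴮ m′ → n ⊙ m ≈ᴮ n ⊙ m′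
  ⊙-congʳ (ret f)    p = ·-congʳ f p
  ⊙-congʳ (send f n) p = send ≈.refl (⊙-congʳ n p)
  ⊙-congʳ (recv n)   p = recv (⊙-congʳ n p)

  ⊙-cong : {n n′ : Behaviour C D X} {m m′ : Behaviour D E Y} →
           n ≈ᴮ n′ → m ≈ᴮ m′ → n ⊙ m ≈ᴮ n′ ⊙ m′
  ⊙-cong {n′ = n′} {m = m} p q = transᴮ (⊙-congˡ m p) (⊙-congʳ n′ q)

  -- Equality of behaviours across propositionally equal boundaries

  infix 4 _≋ᴮ_
  -- An indexed type instead of a transport along three equations: matching on `⟨ p ⟩` identifies
  -- all three boundaries at once.
  data _≋ᴮ_ (n : Behaviour C E X) : Behaviour C′ E′ X′ → Set (o ⊔ ℓ ⊔ e) where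
    ⟨_⟩ : {m : Behaviour C E X} → n ≈ᴮ m → n ≋ᴮ m

  ≋ᴮ-refl : {n : Behaviour C E X} → n ≋ᴮ n
  ≋ᴮ-refl = ⟨ reflᴮ ⟩

  ≋ᴮ-sym : {n : Behaviour C E X} {m : Behaviour C′ E′ X′} → n ≋ᴮ m → m ≋ᴮ n
  ≋ᴮ-sym ⟨ p ⟩ = ⟨ symᴮ p ⟩

  ≋ᴮ-trans : {n : Behaviour C E X} {m : Behaviour C′ E′ X′} {k : Behaviour D F Y} →
             n ≋ᴮ m → m ≋ᴮ k → n ≋ᴮ k
  ≋ᴮ-trans ⟨ p ⟩ ⟨ q ⟩ = ⟨ transᴮ p q ⟩

  ≋ᴮ⇒≈ᴮ : {n m : Behaviour C E X} → n ≋ᴮ m → n ≈ᴮ m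
  ≋ᴮ⇒≈ᴮ ⟨ p ⟩ = p

  castᴮ : C ≡ C′ → E ≡ E′ → Behaviour C E X → Behaviour C′ E′ X
  castᴮ = subst₂ (λ C E → Behaviour C E _)

  castᴮ-≋ : (p : C ≡ C′) (q : E ≡ E′) (n : Behaviour C E X) → castᴮ p q n ≋ᴮ n
  castᴮ-≋ refl refl n = ≋ᴮ-refl

  castᴮ-cong : (p : C ≡ C′) (q : E ≡ E′) {n m : Behaviour C E X} →
               n ≈ᴮ m → castᴮ p q n ≈ᴮ castᴮ p q m
  castᴮ-cong refl refl p = p

  ret-cong-≋ : {f : Hom C E} {g : Hom C′ E′} → f ≋ g → ret f ≋ᴮ ret g
  ret-cong-≋ (refl , refl , p) = ⟨ ret p ⟩

  send-cong-≋ : {f : Hom C (D ⊗₀ A)} {g : Hom C′ (D′ ⊗₀ A)}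
                {n : Behaviour D E X} {m : Behaviour D′ E′ X′} →
                f ≋ g → n ≋ᴮ m → send f n ≋ᴮ send g m
  send-cong-≋ (refl , refl , p) ⟨ q ⟩ = ⟨ send p q ⟩

  recv-cong-≋ : {n : Behaviour (C ⊗₀ A) E X} {m : Behaviour (C′ ⊗₀ A) E′ X′} →
                C ≡ C′ → n ≋ᴮ m → recv n ≋ᴮ recv m
  recv-cong-≋ refl ⟨ p ⟩ = ⟨ recv p ⟩

  ·-cong-≋ : {f : Hom C D} {g : Hom C′ D′} {n : Behaviour D E X} {m : Behaviour D′ E′ X′} →
             f ≋ g → n ≋ᴮ m → f · n ≋ᴮ g · m
  ·-cong-≋ {f = f} {m = m} (refl , refl , p) ⟨ q ⟩ = ⟨ transᴮ (·-congʳ f q) (·-congˡ m p) ⟩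

  ⊲-cong-≋ : {n : Behaviour C D X} {m : Behaviour C′ D′ X′} {f : Hom D E} {g : Hom D′ E′} →
             n ≋ᴮ m → f ≋ g → n ⊲ f ≋ᴮ m ⊲ g
  ⊲-cong-≋ {n = n} {g = g} ⟨ q ⟩ (refl , refl , p) = ⟨ transᴮ (⊲-congʳ n p) (⊲-congˡ g q) ⟩

  ⊙-assoc : (n : Behaviour C D X) (m : Behaviour D F Y) (k : Behaviour F E Z) →
            (n ⊙ m) ⊙ k ≋ᴮ n ⊙ (m ⊙ k)
  ⊙-assoc (ret f)    m k = ⟨ symᴮ (·-⊙ f m k) ⟩
  ⊙-assoc (send f n) m k = send-cong-≋ ≋-refl (⊙-assoc n m k)
  ⊙-assoc (recv n)   m k = recv-cong-≋ refl (⊙-assoc n m k)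

  ⊙-ret : (n : Behaviour C D X) (g : Hom D E) → n ⊙ ret g ≋ᴮ n ⊲ g
  ⊙-ret (ret f)    g = ≋ᴮ-refl
  ⊙-ret (send f n) g = send-cong-≋ ≋-refl (⊙-ret n g)
  ⊙-ret (recv n)   g = recv-cong-≋ refl (⊙-ret n g)

  ⊙-cong-≋ : {n : Behaviour C D X} {m : Behaviour D E Y}
             {n′ : Behaviour C′ D′ X′} {m′ : Behaviour D′ E′ Y′} →
             n ≋ᴮ n′ → m ≋ᴮ m′ → n ⊙ m ≋ᴮ n′ ⊙ m′
  ⊙-cong-≋ ⟨ p ⟩ ⟨ q ⟩ = ⟨ ⊙-cong p q ⟩

  -- Cutting a behaviour along a concatenated boundary

  Split : Obj → Exchange → Exchange → Obj → Set (o ⊔ ℓ)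
  Split C X Y E = Σ[ D ∈ Obj ] Behaviour C D X × Behaviour D E Y

  infix 4 _⟶_ _≃_
  -- A step moves a morphism `g` from the front of the second half to the end of the first. The
  -- equivalence generated by these steps is the coend relation on the object at the cut.
  _⟶_ : Split C X Y E → Split C X Y E → Set (o ⊔ ℓ ⊔ e)
  (D , n , m) ⟶ (D′ , n′ , m′) = Σ[ g ∈ Hom D D′ ] (n ⊲ g ≈ᴮ n′) × (m ≈ᴮ g · m′)

  _≃_ : Split C X Y E → Split C X Y E → Set (o ⊔ ℓ ⊔ e)
  _≃_ = EqClosure _⟶_

  ⟶-cong : {n n′ : Behaviour C D X} {m m′ : Behaviour D E Y} → n ≈ᴮ n′ → m ≈ᴮ m′ →
            (D , n , m) ⟶ (D , n′ , m′)
  ⟶-cong {m′ = m′} p q = 𝟙 _ , transᴮ (⊲-id _) p , transᴮ q (symᴮ (·-id m′))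

  join : Split C X Y E → Behaviour C E (X ++ Y)
  join (_ , n , m) = n ⊙ m

  sendˢ : Hom C (D ⊗₀ A) → Split D X Y E → Split C ((A , ○) ∷ X) Y E
  sendˢ f (D , n , m) = D , send f n , m

  recvˢ : Split (C ⊗₀ A) X Y E → Split C ((A , ●) ∷ X) Y E
  recvˢ (D , n , m) = D , recv n , m

  sendˢ-cong : (f : Hom C (D ⊗₀ A)) {s t : Split D X Y E} → s ≃ t → sendˢ f s ≃ sendˢ f t
  sendˢ-cong f = gmap (sendˢ f) λ (g , p , q) → g , send ≈.refl p , q

  recvˢ-cong : {s t : Split (C ⊗₀ A) X Y E} → s ≃ t → recvˢ {C} s ≃ recvˢ t
  recvˢ-cong = gmap recvˢ λ (g , p , q) → g , recv p , q

  split : ∀ X → Behaviour C E (X ++ Y) → Split C X Y E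
  split []      n          = _ , ret (𝟙 _) , n
  split (_ ∷ X) (send f n) = sendˢ f (split X n)
  split (_ ∷ X) (recv n)   = recvˢ (split X n)

  _·ˢ_ : Hom C′ C → Split C X Y E → Split C′ X Y E
  f ·ˢ (D , n , m) = D , f · n , m

  split-· : ∀ X (f : Hom C′ C) (n : Behaviour C E (X ++ Y)) → split X (f · n) ≃ f ·ˢ split X n
  split-· [] f n =
    Closure.return (f , ret (≈.trans (identityˡ f) (≈.sym (identityʳ f))) , reflᴮ)
  split-· (_ ∷ X) f (send g n) = Closure.reflexive _⟶_
  split-· (_ ∷ X) f (recv n)   = recvˢ-cong (split-· X _ n)

  -- A morphism slid past the last send before the cut may end up beyond the cut, which changes the
  -- middle object, so only `_≃_` can be expected. In the `slide` case, sliding within the first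
  -- half leaves `g ·ˢ split X n` below the send, and `split-·` carries this to `split X (g · n)`.
  split-cong : ∀ X {n m : Behaviour C E (X ++ Y)} → n ≈ᴮ m → split X n ≃ split X m
  split-cong []      p             = Closure.return (⟶-cong reflᴮ p)
  split-cong (_ ∷ X) reflᴮ         = Closure.reflexive _⟶_
  split-cong (_ ∷ X) (symᴮ p)      = Closure.symmetric _⟶_ (split-cong (_ ∷ X) p)
  split-cong (_ ∷ X) (transᴮ p q)  =
    Closure.transitive _⟶_ (split-cong (_ ∷ X) p) (split-cong (_ ∷ X) q)
  split-cong (_ ∷ X) (send {f = f} p q) =
    Closure.transitive _⟶_ (sendˢ-cong f (split-cong X q))
                           (Closure.return (⟶-cong (send p reflᴮ) reflᴮ))
  split-cong (_ ∷ X) (recv p)      = recvˢ-cong (split-cong X p)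
  split-cong (_ ∷ X) (slide f g n) =
    Closure.transitive _⟶_ (Closure.return (⟶-cong (slide f g _) reflᴮ))
                           (Closure.symmetric _⟶_ (sendˢ-cong f (split-· X g n)))

  join-split : ∀ X (n : Behaviour C E (X ++ Y)) → join (split X n) ≈ᴮ n
  join-split []      n          = ·-id n
  join-split (_ ∷ X) (send f n) = send ≈.refl (join-split X n)
  join-split (_ ∷ X) (recv n)   = recv (join-split X n)

  -- `_⊙_` pushes the final morphism of `n` into `m`, and `split` leaves it there. The step moves
  -- exactly this morphism back.
  split-join : (n : Behaviour C D X) (m : Behaviour D E Y) →
               split X (n ⊙ m) ⟶ (D , n , m)
  split-join (ret f)    m = f , ret (identityˡ f) , reflᴮ
  split-join (send f n) m with g , p , q ← split-join n m = g , send ≈.refl p , q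
  split-join (recv n)   m with g , p , q ← split-join n m = g , recv p , q

  -- Behaviour transformers

  -- Modelled on n ↦ n ∣ α for a cell α, which commutes with ⌜ f ⌝ / _ and _ / ⌜ g ⌝ by interchange.
  record Transformer (A B : Obj) (X Y : Exchange) : Set (o ⊔ ℓ ⊔ e) where
    field
      act   : Behaviour C E X → Behaviour (C ⊗₀ A) (E ⊗₀ B) Y
      cong  : {n m : Behaviour C E X} → n ≈ᴮ m → act n ≈ᴮ act m
      act-· : (f : Hom C′ C) (n : Behaviour C E X) → act (f · n) ≈ᴮ f ⊗ʳ A · act n
      act-⊲ : (n : Behaviour C E X) (g : Hom E E′) → act (n ⊲ g) ≈ᴮ act n ⊲ g ⊗ʳ B

    cong-≋ : {n : Behaviour C E X} {m : Behaviour C′ E′ X} → n ≋ᴮ m → act n ≋ᴮ act m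
    cong-≋ ⟨ p ⟩ = ⟨ cong p ⟩

  open Transformer

  infixl 8 _∣ᵀ_

  _∣ᵀ_ : Transformer A B X Y → Transformer C D Y Z → Transformer (A ⊗₀ C) (B ⊗₀ D) X Z
  _∣ᵀ_ {A} {B} {X} {Y} {C} {D} {Z} φ ψ = record
    { act   = λ n → castᴮ (⊗₀.assoc _ _ _) (⊗₀.assoc _ _ _) (act ψ (act φ n))
    ; cong  = λ p → castᴮ-cong _ _ (cong ψ (cong φ p))
    ; act-· = λ f n → ≋ᴮ⇒≈ᴮ (≋ᴮ-trans (castᴮ-≋ _ _ _)
        (≋ᴮ-trans ⟨ transᴮ (cong ψ (act-· φ f n)) (act-· ψ _ _) ⟩
        (·-cong-≋ (≋-sym (⊗ʳ-⊗ʳ f)) (≋ᴮ-sym (castᴮ-≋ _ _ _)))))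
    ; act-⊲ = λ n g → ≋ᴮ⇒≈ᴮ (≋ᴮ-trans (castᴮ-≋ _ _ _)
        (≋ᴮ-trans ⟨ transᴮ (cong ψ (act-⊲ φ n g)) (act-⊲ ψ _ _) ⟩
        (⊲-cong-≋ (≋ᴮ-sym (castᴮ-≋ _ _ _)) (≋-sym (⊗ʳ-⊗ʳ g)))))
    }

  ∣ᵀ-≋ : (φ : Transformer A B X Y) (ψ : Transformer C D Y Z) (n : Behaviour E F X) →
         act (φ ∣ᵀ ψ) n ≋ᴮ act ψ (act φ n)
  ∣ᵀ-≋ φ ψ n = castᴮ-≋ _ _ _

  module _ (φ : Transformer A B X Y) (ψ : Transformer B C X′ Y′) where
    private
      glue : Split D X X′ E → Behaviour (D ⊗₀ A) (E ⊗₀ C) (Y ++ Y′)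
      glue (_ , n , m) = act φ n ⊙ act ψ m

      -- Naturality turns `g` into `g ⊗ʳ B` on both sides of the cut, by `act-·` for `ψ` and `act-⊲`
      -- for `φ`. The two agree because the bottom of `φ` is the top of `ψ`.
      glue-⟶ : {s t : Split D X X′ E} → s ⟶ t → glue s ≈ᴮ glue t
      glue-⟶ {s = _ , n , m} {_ , n′ , m′} (g , p , q) = begin
        act φ n ⊙ act ψ m                ≈⟨ ⊙-congʳ (act φ n) (cong ψ q) ⟩
        act φ n ⊙ act ψ (g · m′)         ≈⟨ ⊙-congʳ (act φ n) (act-· ψ g m′) ⟩
        act φ n ⊙ (g ⊗ʳ B · act ψ m′)    ≈⟨ ⊲-⊙ (act φ n) _ _ ⟨
        (act φ n ⊲ g ⊗ʳ B) ⊙ act ψ m′    ≈⟨ ⊙-congˡ _ (act-⊲ φ n g) ⟨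
        act φ (n ⊲ g) ⊙ act ψ m′         ≈⟨ ⊙-congˡ _ (cong φ p) ⟩
        act φ n′ ⊙ act ψ m′              ∎
        where open ≈ᴮ-Reasoning

      run : Behaviour D E (X ++ X′) → Behaviour (D ⊗₀ A) (E ⊗₀ C) (Y ++ Y′)
      run n = glue (split X n)

      run-cong : {n m : Behaviour D E (X ++ X′)} → n ≈ᴮ m → run n ≈ᴮ run m
      run-cong p =
        gfold (Setoid.isEquivalence (≈ᴮ-setoid _ _ _)) glue glue-⟶ (split-cong X p)

      run-⊙ : (n : Behaviour D F X) (m : Behaviour F E X′) →
              run (n ⊙ m) ≈ᴮ act φ n ⊙ act ψ m
      run-⊙ n m = glue-⟶ (split-join n m)

      -- Once `n` is replaced by the join of its halves, `f` only meets the first half, and `run-⊙`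
      -- reduces the claim to naturality of `φ`. Dually, `run-⊲` rests on naturality of `ψ`.
      run-· : (f : Hom D′ D) (n : Behaviour D E (X ++ X′)) → run (f · n) ≈ᴮ f ⊗ʳ A · run n
      run-· f n with _ , n₁ , n₂ ← split X n | eq ← join-split X n = begin
        run (f · n)                      ≈⟨ run-cong (·-congʳ f eq) ⟨
        run (f · (n₁ ⊙ n₂))              ≈⟨ run-cong (·-⊙ f n₁ n₂) ⟩
        run ((f · n₁) ⊙ n₂)              ≈⟨ run-⊙ (f · n₁) n₂ ⟩
        act φ (f · n₁) ⊙ act ψ n₂        ≈⟨ ⊙-congˡ _ (act-· φ f n₁) ⟩
        (f ⊗ʳ A · act φ n₁) ⊙ act ψ n₂   ≈⟨ ·-⊙ _ (act φ n₁) (act ψ n₂) ⟨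
        f ⊗ʳ A · (act φ n₁ ⊙ act ψ n₂)   ∎
        where open ≈ᴮ-Reasoning

      run-⊲ : (n : Behaviour D E (X ++ X′)) (g : Hom E E′) → run (n ⊲ g) ≈ᴮ run n ⊲ g ⊗ʳ C
      run-⊲ n g with _ , n₁ , n₂ ← split X n | eq ← join-split X n = begin
        run (n ⊲ g)                      ≈⟨ run-cong (⊲-congˡ g eq) ⟨
        run ((n₁ ⊙ n₂) ⊲ g)              ≈⟨ run-cong (⊙-⊲ n₁ n₂ g) ⟩
        run (n₁ ⊙ (n₂ ⊲ g))              ≈⟨ run-⊙ n₁ (n₂ ⊲ g) ⟩
        act φ n₁ ⊙ act ψ (n₂ ⊲ g)        ≈⟨ ⊙-congʳ (act φ n₁) (act-⊲ ψ n₂ g) ⟩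
        act φ n₁ ⊙ (act ψ n₂ ⊲ g ⊗ʳ C)   ≈⟨ ⊙-⊲ (act φ n₁) (act ψ n₂) _ ⟨
        (act φ n₁ ⊙ act ψ n₂) ⊲ g ⊗ʳ C   ∎
        where open ≈ᴮ-Reasoning

    infixl 9 _/ᵀ_
    _/ᵀ_ : Transformer A C (X ++ X′) (Y ++ Y′)
    _/ᵀ_ = record { act = run ; cong = run-cong ; act-· = run-· ; act-⊲ = run-⊲ }

    -- Any decomposition of the input may be used, not only the one computed by `split`. The
    -- equations about vertical composites can thus be checked on a convenient choice.
    /ᵀ-≋ : {n : Behaviour D E (X ++ X′)} (n₁ : Behaviour D F X) (n₂ : Behaviour F E X′) →
           n ≋ᴮ n₁ ⊙ n₂ → act _/ᵀ_ n ≋ᴮ act φ n₁ ⊙ act ψ n₂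
    /ᵀ-≋ n₁ n₂ p = ⟨ transᴮ (run-cong (≋ᴮ⇒≈ᴮ p)) (run-⊙ n₁ n₂) ⟩

  -- Transformers for identities and generators

  idⱽᵀ : ∀ X → Transformer unit unit X X
  idⱽᵀ X .act n     = castᴮ ρ ρ n
  idⱽᵀ X .cong p    = castᴮ-cong ρ ρ p
  idⱽᵀ X .act-· f n = ≋ᴮ⇒≈ᴮ (≋ᴮ-trans (castᴮ-≋ _ _ _)
    (·-cong-≋ (≋-sym (⊗₁-identityʳ f)) (≋ᴮ-sym (castᴮ-≋ _ _ n))))
  idⱽᵀ X .act-⊲ n g = ≋ᴮ⇒≈ᴮ (≋ᴮ-trans (castᴮ-≋ _ _ _)
    (⊲-cong-≋ (≋ᴮ-sym (castᴮ-≋ _ _ n)) (≋-sym (⊗₁-identityʳ g))))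

  value : Behaviour C E [] → Hom C E
  value (ret f) = f

  value-cong : {n m : Behaviour C E []} → n ≈ᴮ m → value n ≈ value m
  value-cong reflᴮ        = ≈.refl
  value-cong (symᴮ p)     = ≈.sym (value-cong p)
  value-cong (transᴮ p q) = ≈.trans (value-cong p) (value-cong q)
  value-cong (ret p)      = p

  value-⊙ : (n : Behaviour C D []) (m : Behaviour D E []) → value (n ⊙ m) ≈ value n ⨾ value m
  value-⊙ (ret f) (ret g) = ≈.refl

  received : Behaviour C E ((A , ●) ∷ X) → Behaviour (C ⊗₀ A) E X
  received (recv n) = n

  received-cong : {n m : Behaviour C E ((A , ●) ∷ X)} → n ≈ᴮ m → received n ≈ᴮ received m
  received-cong reflᴮ        = reflᴮ
  received-cong (symᴮ p)     = symᴮ (received-cong p)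
  received-cong (transᴮ p q) = transᴮ (received-cong p) (received-cong q)
  received-cong (recv p)     = p

  -- Composing away the object kept across the send gives a morphism that is invariant under
  -- `slide`.
  sent : Behaviour C E (A °) → Hom C (E ⊗₀ A)
  sent (send f n) = f ⨾ value n ⊗ʳ _

  sent-cong : {n m : Behaviour C E (A °)} → n ≈ᴮ m → sent n ≈ sent m
  sent-cong reflᴮ               = ≈.refl
  sent-cong (symᴮ p)            = ≈.sym (sent-cong p)
  sent-cong (transᴮ p q)        = ≈.trans (sent-cong p) (sent-cong q)
  sent-cong (send p q)          = ⨾-cong p (⊗ʳ-cong (value-cong q))
  sent-cong (slide f g (ret h)) =
    ≈.trans (assoc f _ _) (⨾-cong ≈.refl (≈.sym (⊗ʳ-⨾ g h)))

  ⌜_⌝ᵀ : Hom A B → Transformer A B [] []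
  ⌜ f ⌝ᵀ .act n           = ret (value n ⊗₁ f)
  ⌜ f ⌝ᵀ .cong p          = ret (⊗₁-cong (value-cong p) ≈.refl)
  ⌜ f ⌝ᵀ .act-· g (ret h) = ret (≈.trans (⊗₁-cong ≈.refl (≈.sym (identityˡ f))) (⊗₁-⨾ g h _ f))
  ⌜ f ⌝ᵀ .act-⊲ (ret h) g = ret (≈.trans (⊗₁-cong ≈.refl (≈.sym (identityʳ f))) (⊗₁-⨾ h g f _))

  s°ᵀ : ∀ A → Transformer A unit [] (A °)
  s°ᵀ A .act n           = send (𝟙 _) (ret (cast refl ρ (value n)))
  s°ᵀ A .cong p          = send ≈.refl (ret (≋⇒≈ (≋-trans (cast-≋ _ _ _)
    (≋-trans (≈⇒≋ (value-cong p)) (≋-sym (cast-≋ _ _ _))))))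
  -- The action places the morphism of the input after the send, whereas `f ⊗ʳ A` acts before it;
  -- `slide` reconciles the two.
  s°ᵀ A .act-· f (ret g) = transᴮ (send ≈.refl (ret (≋⇒≈ (≋-trans (cast-≋ _ _ _)
    (⨾-cong-≋ ≋-refl (≋-sym (cast-≋ _ _ g)))))))
    (transᴮ (symᴮ (slide (𝟙 _) f _))
    (send (≈.trans (identityˡ _) (≈.sym (identityʳ _))) reflᴮ))
  s°ᵀ A .act-⊲ (ret f) g = send ≈.refl (ret (≋⇒≈ (≋-trans (cast-≋ _ _ _)
    (⨾-cong-≋ (≋-sym (cast-≋ _ _ f)) (≋-sym (⊗₁-identityʳ g))))))

  r°ᵀ : ∀ A → Transformer unit A (A °) []
  r°ᵀ A .act n                = ret (cast ρ refl (sent n))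
  r°ᵀ A .cong p               = ret (≋⇒≈ (≋-trans (cast-≋ _ _ _)
    (≋-trans (≈⇒≋ (sent-cong p)) (≋-sym (cast-≋ _ _ _)))))
  r°ᵀ A .act-· f (send g n)   = ret (≋⇒≈ (≋-trans (cast-≋ _ _ _)
    (≋-trans (≈⇒≋ (assoc f g _)) (⨾-cong-≋ (≋-sym (⊗₁-identityʳ f)) (≋-sym (cast-≋ _ _ _))))))
  r°ᵀ A .act-⊲ (send f (ret h)) g = ret (≋⇒≈ (≋-trans (cast-≋ _ _ _)
    (≋-trans (≈⇒≋ (≈.trans (⨾-cong ≈.refl (⊗ʳ-⨾ h g)) (≈.sym (assoc f _ _))))
    (⨾-cong-≋ (≋-sym (cast-≋ _ _ _)) ≋-refl))))

  s•ᵀ : ∀ A → Transformer A unit (A •) []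
  s•ᵀ A .act n                 = ret (cast refl ρ (value (received n)))
  s•ᵀ A .cong p                = ret (≋⇒≈ (≋-trans (cast-≋ _ _ _)
    (≋-trans (≈⇒≋ (value-cong (received-cong p))) (≋-sym (cast-≋ _ _ _)))))
  s•ᵀ A .act-· f (recv (ret g)) = ret (≋⇒≈ (≋-trans (cast-≋ _ _ _)
    (⨾-cong-≋ ≋-refl (≋-sym (cast-≋ _ _ g)))))
  s•ᵀ A .act-⊲ (recv (ret f)) g = ret (≋⇒≈ (≋-trans (cast-≋ _ _ _)
    (⨾-cong-≋ (≋-sym (cast-≋ _ _ f)) (≋-sym (⊗₁-identityʳ g)))))

  r•ᵀ : ∀ A → Transformer unit A [] (A •)
  r•ᵀ A .act n           = recv (ret (cast ρ refl (value n) ⊗ʳ A))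
  r•ᵀ A .cong p          = recv (ret (⊗ʳ-cong (≋⇒≈ (≋-trans (cast-≋ _ _ _)
    (≋-trans (≈⇒≋ (value-cong p)) (≋-sym (cast-≋ _ _ _)))))))
  r•ᵀ A .act-· f (ret g) = recv (ret (≈.trans (⊗ʳ-cong (≋⇒≈ (≋-trans (cast-≋ _ _ _)
    (⨾-cong-≋ (≋-sym (⊗₁-identityʳ f)) (≋-sym (cast-≋ _ _ g)))))) (⊗ʳ-⨾ _ _)))
  r•ᵀ A .act-⊲ (ret f) g = recv (ret (≈.trans (⊗ʳ-cong (≋⇒≈ (≋-trans (cast-≋ _ _ _)
    (⨾-cong-≋ (≋-sym (cast-≋ _ _ f)) ≋-refl)))) (⊗ʳ-⨾ _ _)))

  -- Interpretation of cells and its soundness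

  ⟦_⟧ : Cell A B X Y → Transformer A B X Y
  ⟦ α ∣ β ⟧  = ⟦ α ⟧ ∣ᵀ ⟦ β ⟧
  ⟦ α / β ⟧  = ⟦ α ⟧ /ᵀ ⟦ β ⟧
  ⟦ idᴴ A ⟧  = ⌜ 𝟙 A ⌝ᵀ
  ⟦ idⱽ X ⟧  = idⱽᵀ X
  ⟦ s° A ⟧   = s°ᵀ A
  ⟦ r° A ⟧   = r°ᵀ A
  ⟦ s• A ⟧   = s•ᵀ A
  ⟦ r• A ⟧   = r•ᵀ A
  ⟦ ⌜ f ⌝ ⟧  = ⌜ f ⌝ᵀ

  infix 4 _≋ᵀ_
  -- The inputs are compared heterogeneously because left boundaries may agree only propositionally.
  -- The relation does not force the boundaries to agree, being vacuous when no inputs match;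
  -- transitivity and congruence therefore take `SameBoundaries`, which `∼⇒boundaries` supplies.
  _≋ᵀ_ : Transformer A B X Y → Transformer A′ B′ X′ Y′ → Set (o ⊔ ℓ ⊔ e)
  _≋ᵀ_ {X = X} {X′ = X′} φ ψ =
    ∀ {C E} {n : Behaviour C E X} {m : Behaviour C E X′} → n ≋ᴮ m → act φ n ≋ᴮ act ψ m

  decompose : ∀ X (n : Behaviour C E (X ++ Y)) → Σ[ s ∈ Split C X Y E ] join s ≈ᴮ n
  decompose X n = split X n , join-split X n

  SameBoundaries : (A B A′ B′ : Obj) (X Y X′ Y′ : Exchange) → Set o
  SameBoundaries A B A′ B′ X Y X′ Y′ = A ≡ A′ × B ≡ B′ × X ≡ X′ × Y ≡ Y′

  ≋ᵀ-trans : {φ : Transformer A B X Y} {ψ : Transformer A′ B′ X′ Y′} {χ : Transformer C D X″ Y″} →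
             SameBoundaries A B A′ B′ X Y X′ Y′ → φ ≋ᵀ ψ → ψ ≋ᵀ χ → φ ≋ᵀ χ
  ≋ᵀ-trans (refl , refl , refl , refl) q r p = ≋ᴮ-trans (q ≋ᴮ-refl) (r p)

  ∣ᵀ-cong : {φ : Transformer A B X Y} {φ′ : Transformer A′ B′ X′ Y′}
            {ψ : Transformer C D Y Z} {ψ′ : Transformer C′ D′ Y′ Z′} →
            SameBoundaries A B A′ B′ X Y X′ Y′ → SameBoundaries C D C′ D′ Y Z Y′ Z′ →
            φ ≋ᵀ φ′ → ψ ≋ᵀ ψ′ → (φ ∣ᵀ ψ) ≋ᵀ (φ′ ∣ᵀ ψ′)
  ∣ᵀ-cong (refl , refl , refl , refl) (refl , refl , refl , refl) q r p =
    ≋ᴮ-trans (castᴮ-≋ _ _ _) (≋ᴮ-trans (r (q p)) (≋ᴮ-sym (castᴮ-≋ _ _ _)))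

  /ᵀ-cong : {φ : Transformer A B X Y} {φ′ : Transformer A′ B′ X′ Y′}
            {ψ : Transformer B C X″ Y″} {ψ′ : Transformer B′ C′ Z Z′} →
            SameBoundaries A B A′ B′ X Y X′ Y′ → SameBoundaries B C B′ C′ X″ Y″ Z Z′ →
            φ ≋ᵀ φ′ → ψ ≋ᵀ ψ′ → (φ /ᵀ ψ) ≋ᵀ (φ′ /ᵀ ψ′)
  /ᵀ-cong {X = X} {φ = φ} {φ′} {ψ} {ψ′}
          (refl , refl , refl , refl) (refl , refl , refl , refl) q r {n = n} p
    with (_ , n₁ , n₂) , eq ← decompose X n =
    ≋ᴮ-trans (/ᵀ-≋ φ ψ n₁ n₂ ⟨ symᴮ eq ⟩)
    (≋ᴮ-trans (⊙-cong-≋ (q (≋ᴮ-refl {n = n₁})) (r (≋ᴮ-refl {n = n₂})))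
    (≋ᴮ-sym (/ᵀ-≋ φ′ ψ′ n₁ n₂ (≋ᴮ-trans (≋ᴮ-sym p) ⟨ symᴮ eq ⟩))))

  -- Induction on the derivation. Most axioms for `_/_` are checked on a decomposed input through
  -- `/ᵀ-≋`; the yanking equations reduce to unit laws of 𝔸 on normal forms.
  sound : {α : Cell A B X Y} {β : Cell A′ B′ X′ Y′} → α ∼ β → ⟦ α ⟧ ≋ᵀ ⟦ β ⟧
  sound {α = α} ∼-refl ⟨ p ⟩ = ⟨ cong ⟦ α ⟧ p ⟩
  sound (∼-sym r) p          = ≋ᴮ-sym (sound r (≋ᴮ-sym p))
  sound (∼-trans {α = α} {β} {γ} r s) =
    ≋ᵀ-trans {φ = ⟦ α ⟧} {⟦ β ⟧} {⟦ γ ⟧} (∼⇒boundaries r) (sound r) (sound s)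
  sound (∣-cong {α = α} {α′} {β} {β′} r s) =
    ∣ᵀ-cong {φ = ⟦ α ⟧} {⟦ α′ ⟧} {⟦ β ⟧} {⟦ β′ ⟧}
            (∼⇒boundaries r) (∼⇒boundaries s) (sound r) (sound s)
  sound (/-cong {α = α} {α′} {β} {β′} r s) =
    /ᵀ-cong {φ = ⟦ α ⟧} {⟦ α′ ⟧} {⟦ β ⟧} {⟦ β′ ⟧}
            (∼⇒boundaries r) (∼⇒boundaries s) (sound r) (sound s)
  sound (∣-assoc α β γ) {n = n} {m} ⟨ p ⟩ =
    ≋ᴮ-trans (∣ᵀ-≋ ⟦ α ∣ β ⟧ ⟦ γ ⟧ n)
    (≋ᴮ-trans (cong-≋ ⟦ γ ⟧ (∣ᵀ-≋ ⟦ α ⟧ ⟦ β ⟧ n))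
    (≋ᴮ-trans ⟨ cong ⟦ γ ⟧ (cong ⟦ β ⟧ (cong ⟦ α ⟧ p)) ⟩
    (≋ᴮ-sym (≋ᴮ-trans (∣ᵀ-≋ ⟦ α ⟧ ⟦ β ∣ γ ⟧ m) (∣ᵀ-≋ ⟦ β ⟧ ⟦ γ ⟧ (act ⟦ α ⟧ m))))))
  sound (∣-identityˡ α) ⟨ p ⟩ =
    ≋ᴮ-trans (castᴮ-≋ _ _ _) (cong-≋ ⟦ α ⟧ (≋ᴮ-trans (castᴮ-≋ _ _ _) ⟨ p ⟩))
  sound (∣-identityʳ {Y = Y} α) {n = n} ⟨ p ⟩ =
    ≋ᴮ-trans (∣ᵀ-≋ ⟦ α ⟧ (idⱽᵀ Y) n) (≋ᴮ-trans (castᴮ-≋ _ _ _) ⟨ cong ⟦ α ⟧ p ⟩)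
  sound (/-assoc {X = X} {X′ = X′} {X″ = X″} α β γ) {n = n} p
    with (_ , n₁₂ , n₃) , eq ← decompose (X ++ X′) n
    with (_ , n₁ , n₂) , eq′ ← decompose X n₁₂ =
    -- The same three pieces serve both sides: bracketed to the left they decompose `n`, bracketed
    -- to the right they decompose the other input.
    ≋ᴮ-trans (/ᵀ-≋ (⟦ α ⟧ /ᵀ ⟦ β ⟧) ⟦ γ ⟧ n₁₂ n₃ ⟨ symᴮ eq ⟩)
    (≋ᴮ-trans (⊙-cong-≋ (/ᵀ-≋ ⟦ α ⟧ ⟦ β ⟧ n₁ n₂ ⟨ symᴮ eq′ ⟩) (≋ᴮ-refl {n = act ⟦ γ ⟧ n₃}))
    (≋ᴮ-trans (⊙-assoc (act ⟦ α ⟧ n₁) (act ⟦ β ⟧ n₂) (act ⟦ γ ⟧ n₃))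
    (≋ᴮ-sym (≋ᴮ-trans
      (/ᵀ-≋ ⟦ α ⟧ (⟦ β ⟧ /ᵀ ⟦ γ ⟧) n₁ (n₂ ⊙ n₃) (≋ᴮ-trans (≋ᴮ-sym p)
        (≋ᴮ-trans ⟨ symᴮ (transᴮ (⊙-congˡ n₃ eq′) eq) ⟩ (⊙-assoc n₁ n₂ n₃))))
      (⊙-cong-≋ (≋ᴮ-refl {n = act ⟦ α ⟧ n₁}) (/ᵀ-≋ ⟦ β ⟧ ⟦ γ ⟧ n₂ n₃ ≋ᴮ-refl))))))
  sound (/-identityˡ α) ⟨ p ⟩ =
    ⟨ transᴮ (·-congˡ _ (⊗₁-id _ _)) (transᴮ (·-id _) (cong ⟦ α ⟧ p)) ⟩
  sound (/-identityʳ {B = B} α) {m = m} p =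
    -- Instead of splitting `n`, whose boundary is `X ++ []`, take `m` followed by an identity as
    -- its decomposition.
    ≋ᴮ-trans (/ᵀ-≋ ⟦ α ⟧ ⌜ 𝟙 B ⌝ᵀ m (ret (𝟙 _))
      (≋ᴮ-trans p (≋ᴮ-sym (≋ᴮ-trans (⊙-ret m (𝟙 _)) ⟨ ⊲-id m ⟩))))
    (≋ᴮ-trans (⊙-ret (act ⟦ α ⟧ m) _)
    ⟨ transᴮ (⊲-congʳ (act ⟦ α ⟧ m) (⊗₁-id _ _)) (⊲-id _) ⟩)
  sound (idᴴ-⊗ A B) ⟨ p ⟩ = ≋ᴮ-trans (castᴮ-≋ _ _ _)
    (ret-cong-≋ (≋-trans (≋-sym (⊗ʳ-⊗ʳ _)) (≈⇒≋ (⊗ʳ-cong (value-cong p)))))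
  sound (idⱽ-⊗ X Y) {n = n} ⟨ p ⟩ =
    ≋ᴮ-trans (⊙-cong-≋ (castᴮ-≋ ρ ρ _) (castᴮ-≋ ρ ρ _))
    (≋ᴮ-trans ⟨ transᴮ (join-split X n) p ⟩ (≋ᴮ-sym (castᴮ-≋ _ _ _)))
  sound idᴴ∼idⱽ {n = ret f} p =
    ≋ᴮ-trans (ret-cong-≋ (⊗₁-identityʳ f)) (≋ᴮ-trans p (≋ᴮ-sym (castᴮ-≋ _ _ _)))
  sound (interchange {X = X} α β γ δ) {n = n} ⟨ p ⟩
    with (_ , n₁ , n₂) , eq ← decompose X n =
    ≋ᴮ-trans (∣ᵀ-≋ ⟦ α / β ⟧ ⟦ γ / δ ⟧ n)
    -- The result of the left column is already cut at the boundary between `γ` and `δ`, so the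
    -- right column acts on its two halves.
    (≋ᴮ-trans (/ᵀ-≋ ⟦ γ ⟧ ⟦ δ ⟧ (act ⟦ α ⟧ n₁) (act ⟦ β ⟧ n₂)
                    (/ᵀ-≋ ⟦ α ⟧ ⟦ β ⟧ n₁ n₂ ⟨ symᴮ eq ⟩))
    (≋ᴮ-trans (⊙-cong-≋ (≋ᴮ-sym (∣ᵀ-≋ ⟦ α ⟧ ⟦ γ ⟧ n₁)) (≋ᴮ-sym (∣ᵀ-≋ ⟦ β ⟧ ⟦ δ ⟧ n₂)))
    (≋ᴮ-sym (/ᵀ-≋ ⟦ α ∣ γ ⟧ ⟦ β ∣ δ ⟧ n₁ n₂ ⟨ symᴮ (transᴮ eq p) ⟩))))
  sound (yank°-∣ A) ⟨ p ⟩ = ≋ᴮ-trans (castᴮ-≋ _ _ _)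
    (ret-cong-≋ (≋-trans (cast-≋ _ _ _) (≋-trans (≈⇒≋ (identityˡ _))
    (⊗-cong-≋ (≋-trans (cast-≋ _ _ _) (≈⇒≋ (value-cong p))) ≋-refl))))
  sound (yank°-/ A) {n = send f (ret g)} p =
    -- The split puts `ret (𝟙 _)` at the end of the first half, so `r°` yields `f` up to identities,
    -- and `s°` sends it again with `g` as the continuation.
    ≋ᴮ-trans (send-cong-≋
      (≋-trans (≈⇒≋ (identityʳ _)) (≋-trans (cast-≋ _ _ _)
        (≈⇒≋ (≈.trans (⨾-cong ≈.refl (⊗₁-id _ _)) (identityʳ f)))))
      (ret-cong-≋ (cast-≋ _ _ g)))
    (≋ᴮ-trans p (≋ᴮ-sym (castᴮ-≋ _ _ _)))
  sound (yank•-∣ A) ⟨ p ⟩ = ≋ᴮ-trans (castᴮ-≋ _ _ _)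
    (ret-cong-≋ (≋-trans (cast-≋ _ _ _)
    (⊗-cong-≋ (≋-trans (cast-≋ _ _ _) (≈⇒≋ (value-cong p))) ≋-refl)))
  sound (yank•-/ A) {n = recv (ret f)} p =
    ≋ᴮ-trans (recv-cong-≋ (⊗₀.identityʳ _) (ret-cong-≋
      (≋-trans (⨾-cong-≋ (⊗-cong-≋ (cast-≋ _ _ _) ≋-refl) (cast-≋ _ _ f))
      (≈⇒≋ (≈.trans (⨾-cong (⊗₁-id _ _) ≈.refl) (identityˡ f))))))
    (≋ᴮ-trans p (≋ᴮ-sym (castᴮ-≋ _ _ _)))
  sound (⌜⌝-cong p) ⟨ q ⟩ = ⟨ ret (⊗₁-cong (value-cong q) p) ⟩
  sound (⌜⌝-⨾ f g) ⟨ p ⟩ = ⟨ ret (≈.trans (≈.sym (⊗₁-⨾ _ _ f g))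
    (⊗₁-cong (≈.trans (identityˡ _) (value-cong p)) ≈.refl)) ⟩
  sound (⌜⌝-id A) ⟨ p ⟩ = ⟨ ret (⊗ʳ-cong (value-cong p)) ⟩
  sound (⌜⌝-⊗ f g) ⟨ p ⟩ = ≋ᴮ-trans (castᴮ-≋ _ _ _)
    (ret-cong-≋ (≋-trans (⊗₁-assoc _ f g) (≈⇒≋ (⊗₁-cong (value-cong p) ≈.refl))))

  -- Reification

  module ∼-Reasoning where
    infix  3 _∎
    infixr 2 _∼⟨_⟩_ _∼⟨_⟨_

    _∼⟨_⟩_ : (α : Cell A B X Y) {β : Cell A′ B′ X′ Y′} {γ : Cell C D X″ Y″} →
             α ∼ β → β ∼ γ → α ∼ γ
    _ ∼⟨ p ⟩ q = ∼-trans p q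

    _∼⟨_⟨_ : (α : Cell A B X Y) {β : Cell A′ B′ X′ Y′} {γ : Cell C D X″ Y″} →
             β ∼ α → β ∼ γ → α ∼ γ
    _ ∼⟨ p ⟨ q = ∼-trans (∼-sym p) q

    _∎ : (α : Cell A B X Y) → α ∼ α
    _ ∎ = ∼-refl

  open ∼-Reasoning

  castᶜ : A ≡ A′ → B ≡ B′ → Cell A B X Y → Cell A′ B′ X Y
  castᶜ p q = subst₄ Cell p q refl refl

  castᶜ-∼ : (p : A ≡ A′) (q : B ≡ B′) (α : Cell A B X Y) → castᶜ p q α ∼ α
  castᶜ-∼ refl refl α = ∼-refl

  ⌜⌝-cong-≋ : {f : Hom A B} {g : Hom A′ B′} → f ≋ g → ⌜ f ⌝ ∼ ⌜ g ⌝
  ⌜⌝-cong-≋ (refl , refl , p) = ⌜⌝-cong p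

  ⌜cast⌝ : (p : A ≡ A′) (q : B ≡ B′) (f : Hom A B) → ⌜ cast p q f ⌝ ∼ ⌜ f ⌝
  ⌜cast⌝ p q f = ⌜⌝-cong-≋ (cast-≋ p q f)

  ⌜⊗ʳ⌝ : (f : Hom A B) → ⌜ f ⊗ʳ C ⌝ ∼ ⌜ f ⌝ ∣ idᴴ C
  ⌜⊗ʳ⌝ f = ∼-trans (∼-sym (⌜⌝-⊗ f (𝟙 _))) (∣-cong ∼-refl (⌜⌝-id _))

  ∣-idᴴ-unit : (α : Cell A B X []) → α ∣ idᴴ unit ∼ α
  ∣-idᴴ-unit α = ∼-trans (∣-cong ∼-refl idᴴ∼idⱽ) (∣-identityʳ α)

  /-congˡ : {α : Cell A B X Y} {α′ : Cell A′ B X′ Y′} {β : Cell B C X″ Y″} →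
            α ∼ α′ → α / β ∼ α′ / β
  /-congˡ p = /-cong p ∼-refl

  sendᶜ : ∀ D A → Cell (D ⊗₀ A) D [] (A °)
  sendᶜ D A = castᶜ refl (⊗₀.identityʳ D) (idᴴ D ∣ s° A)

  recvᶜ : ∀ C A → Cell C (C ⊗₀ A) [] (A •)
  recvᶜ C A = castᶜ (⊗₀.identityʳ C) refl (idᴴ C ∣ r• A)

  ⌈_⌉ : Behaviour C E X → Cell C E [] X
  ⌈ ret f ⌉    = ⌜ f ⌝
  ⌈ send f n ⌉ = ⌜ f ⌝ / sendᶜ _ _ / ⌈ n ⌉
  ⌈ recv n ⌉   = recvᶜ _ _ / ⌈ n ⌉

  ⌈castᴮ⌉ : (p : C ≡ C′) (q : E ≡ E′) (n : Behaviour C E X) → ⌈ castᴮ p q n ⌉ ∼ ⌈ n ⌉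
  ⌈castᴮ⌉ refl refl n = ∼-refl

  -- Side by side, `f` and the corner are independent; padding both with identities and applying
  -- interchange schedules the send first.
  sendᶜ-natural : (f : Hom C D) → ⌜ f ⌝ ∣ s° A ∼ sendᶜ C A / ⌜ f ⌝
  sendᶜ-natural {C} {D} {A} f =
    ⌜ f ⌝ ∣ s° A                            ∼⟨ ∣-cong (/-identityˡ _) (/-identityʳ _) ⟨
    (idᴴ C / ⌜ f ⌝) ∣ (s° A / idᴴ unit)     ∼⟨ interchange _ _ _ _ ⟩
    (idᴴ C ∣ s° A) / (⌜ f ⌝ ∣ idᴴ unit)     ∼⟨ /-cong (∼-sym (castᶜ-∼ _ _ _)) (∣-idᴴ-unit _) ⟩
    sendᶜ C A / ⌜ f ⌝                       ∎

  recvᶜ-⊗ʳ : (f : Hom C D) → recvᶜ C A / ⌜ f ⊗ʳ A ⌝ ∼ ⌜ f ⌝ ∣ r• A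
  recvᶜ-⊗ʳ {C} {D} {A} f =
    recvᶜ C A / ⌜ f ⊗ʳ A ⌝                  ∼⟨ /-cong (castᶜ-∼ _ _ _) (⌜⊗ʳ⌝ f) ⟩
    (idᴴ C ∣ r• A) / (⌜ f ⌝ ∣ idᴴ A)        ∼⟨ interchange _ _ _ _ ⟨
    (idᴴ C / ⌜ f ⌝) ∣ (r• A / idᴴ A)        ∼⟨ ∣-cong (/-identityˡ _) (/-identityʳ _) ⟩
    ⌜ f ⌝ ∣ r• A                            ∎

  -- Both schedules of `f` and the receive equal `⌜ f ⌝ ∣ r• A`. This justifies the `recv` clause of
  -- `_·_`.
  recvᶜ-natural : (f : Hom C D) → recvᶜ C A / ⌜ f ⊗ʳ A ⌝ ∼ ⌜ f ⌝ / recvᶜ D A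
  recvᶜ-natural {C} {D} {A} f =
    recvᶜ C A / ⌜ f ⊗ʳ A ⌝                  ∼⟨ recvᶜ-⊗ʳ f ⟩
    ⌜ f ⌝ ∣ r• A                            ∼⟨ ∣-cong (/-identityʳ _) (/-identityˡ _) ⟨
    (⌜ f ⌝ / idᴴ D) ∣ (idᴴ unit / r• A)     ∼⟨ interchange _ _ _ _ ⟩
    (⌜ f ⌝ ∣ idᴴ unit) / (idᴴ D ∣ r• A)     ∼⟨ /-cong (∣-idᴴ-unit _) (∼-sym (castᶜ-∼ _ _ _)) ⟩
    ⌜ f ⌝ / recvᶜ D A                       ∎

  ⌈⌉-· : (f : Hom C′ C) (n : Behaviour C E X) → ⌈ f · n ⌉ ∼ ⌜ f ⌝ / ⌈ n ⌉
  ⌈⌉-· f (ret g) = ∼-sym (⌜⌝-⨾ f g)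
  ⌈⌉-· f (send g n) =
    ⌜ f ⨾ g ⌝ / sendᶜ _ _ / ⌈ n ⌉           ∼⟨ /-congˡ (/-congˡ (∼-sym (⌜⌝-⨾ f g))) ⟩
    ⌜ f ⌝ / ⌜ g ⌝ / sendᶜ _ _ / ⌈ n ⌉       ∼⟨ /-congˡ (/-assoc _ _ _) ⟩
    ⌜ f ⌝ / (⌜ g ⌝ / sendᶜ _ _) / ⌈ n ⌉     ∼⟨ /-assoc _ _ _ ⟩
    ⌜ f ⌝ / (⌜ g ⌝ / sendᶜ _ _ / ⌈ n ⌉)     ∎
  ⌈⌉-· f (recv n) =
    recvᶜ _ _ / ⌈ f ⊗ʳ _ · n ⌉              ∼⟨ /-cong ∼-refl (⌈⌉-· (f ⊗ʳ _) n) ⟩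
    recvᶜ _ _ / (⌜ f ⊗ʳ _ ⌝ / ⌈ n ⌉)        ∼⟨ /-assoc _ _ _ ⟨
    recvᶜ _ _ / ⌜ f ⊗ʳ _ ⌝ / ⌈ n ⌉          ∼⟨ /-congˡ (recvᶜ-natural f) ⟩
    ⌜ f ⌝ / recvᶜ _ _ / ⌈ n ⌉               ∼⟨ /-assoc _ _ _ ⟩
    ⌜ f ⌝ / (recvᶜ _ _ / ⌈ n ⌉)             ∎

  ⌈⌉-⊙ : (n : Behaviour C D X) (m : Behaviour D E Y) → ⌈ n ⊙ m ⌉ ∼ ⌈ n ⌉ / ⌈ m ⌉
  ⌈⌉-⊙ (ret f)    m = ⌈⌉-· f m
  ⌈⌉-⊙ (send f n) m = ∼-trans (/-cong ∼-refl (⌈⌉-⊙ n m)) (∼-sym (/-assoc _ _ _))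
  ⌈⌉-⊙ (recv n)   m = ∼-trans (/-cong ∼-refl (⌈⌉-⊙ n m)) (∼-sym (/-assoc _ _ _))

  ⌈⌉-split : ∀ X (n : Behaviour C E (X ++ Y)) →
             let _ , n₁ , n₂ = split X n in ⌈ n ⌉ ∼ ⌈ n₁ ⌉ / ⌈ n₂ ⌉
  ⌈⌉-split [] n = ∼-sym (∼-trans (/-congˡ (⌜⌝-id _)) (/-identityˡ _))
  ⌈⌉-split (_ ∷ X) (send f n) = ∼-trans (/-cong ∼-refl (⌈⌉-split X n)) (∼-sym (/-assoc _ _ _))
  ⌈⌉-split (_ ∷ X) (recv n)   = ∼-trans (/-cong ∼-refl (⌈⌉-split X n)) (∼-sym (/-assoc _ _ _))

  sendᶜ-∣-r° : ∀ D A → sendᶜ D A ∣ r° A ∼ idᴴ (D ⊗₀ A)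
  sendᶜ-∣-r° D A =
    sendᶜ D A ∣ r° A                        ∼⟨ ∣-cong (castᶜ-∼ _ _ _) ∼-refl ⟩
    idᴴ D ∣ s° A ∣ r° A                     ∼⟨ ∣-assoc _ _ _ ⟩
    idᴴ D ∣ (s° A ∣ r° A)                   ∼⟨ ∣-cong ∼-refl (yank°-∣ A) ⟩
    idᴴ D ∣ idᴴ A                           ∼⟨ idᴴ-⊗ D A ⟩
    idᴴ (D ⊗₀ A)                            ∎

  recvᶜ-∣-s• : ∀ C A → recvᶜ C A ∣ s• A ∼ idᴴ (C ⊗₀ A)
  recvᶜ-∣-s• C A =
    recvᶜ C A ∣ s• A                        ∼⟨ ∣-cong (castᶜ-∼ _ _ _) ∼-refl ⟩
    idᴴ C ∣ r• A ∣ s• A                     ∼⟨ ∣-assoc _ _ _ ⟩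
    idᴴ C ∣ (r• A ∣ s• A)                   ∼⟨ ∣-cong ∼-refl (yank•-∣ A) ⟩
    idᴴ C ∣ idᴴ A                           ∼⟨ idᴴ-⊗ C A ⟩
    idᴴ (C ⊗₀ A)                            ∎

  -- Recursion on `α`. The left boundary of a corner dictates the shape of `n`: `r°` meets a send
  -- and `s•` a receive, and yanking cancels the pair; `s°` and `r•` meet a `ret` and add one
  -- communication to the normal form.
  ⌈⌉-∣ : (n : Behaviour C E X) (α : Cell A B X Y) → ⌈ n ⌉ ∣ α ∼ ⌈ act ⟦ α ⟧ n ⌉
  ⌈⌉-∣ n (α ∣ β) =
    ⌈ n ⌉ ∣ (α ∣ β)                         ∼⟨ ∣-assoc _ _ _ ⟨
    ⌈ n ⌉ ∣ α ∣ β                           ∼⟨ ∣-cong (⌈⌉-∣ n α) ∼-refl ⟩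
    ⌈ act ⟦ α ⟧ n ⌉ ∣ β                     ∼⟨ ⌈⌉-∣ _ β ⟩
    ⌈ act ⟦ β ⟧ (act ⟦ α ⟧ n) ⌉             ∼⟨ ⌈castᴮ⌉ _ _ _ ⟨
    ⌈ act ⟦ α ∣ β ⟧ n ⌉                     ∎
  ⌈⌉-∣ n (_/_ {X = X} α β) with _ , n₁ , n₂ ← split X n | eq ← ⌈⌉-split X n =
    ⌈ n ⌉ ∣ α / β                           ∼⟨ ∣-cong eq ∼-refl ⟩
    ⌈ n₁ ⌉ / ⌈ n₂ ⌉ ∣ α / β                 ∼⟨ interchange _ _ _ _ ⟩
    (⌈ n₁ ⌉ ∣ α) / (⌈ n₂ ⌉ ∣ β)             ∼⟨ /-cong (⌈⌉-∣ n₁ α) (⌈⌉-∣ n₂ β) ⟩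
    ⌈ act ⟦ α ⟧ n₁ ⌉ / ⌈ act ⟦ β ⟧ n₂ ⌉     ∼⟨ ⌈⌉-⊙ (act ⟦ α ⟧ n₁) _ ⟨
    ⌈ act ⟦ α ⟧ n₁ ⊙ act ⟦ β ⟧ n₂ ⌉         ∎
  ⌈⌉-∣ (ret f) (idᴴ A) = ∼-sym (⌜⊗ʳ⌝ f)
  ⌈⌉-∣ n (idⱽ X) = ∼-trans (∣-identityʳ _) (∼-sym (⌈castᴮ⌉ _ _ n))
  ⌈⌉-∣ (ret f) (s° A) =
    ⌜ f ⌝ ∣ s° A                            ∼⟨ sendᶜ-natural f ⟩
    sendᶜ _ A / ⌜ f ⌝                       ∼⟨ /-congˡ (/-identityˡ _) ⟨
    idᴴ _ / sendᶜ _ A / ⌜ f ⌝               ∼⟨ /-congˡ (/-congˡ (⌜⌝-id _)) ⟨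
    ⌜ 𝟙 _ ⌝ / sendᶜ _ A / ⌜ f ⌝             ∼⟨ /-cong ∼-refl (⌜cast⌝ _ _ f) ⟨
    ⌜ 𝟙 _ ⌝ / sendᶜ _ A / ⌜ cast refl ρ f ⌝ ∎
  ⌈⌉-∣ (send f (ret g)) (r° A) =
    ⌜ f ⌝ / sendᶜ _ A / ⌜ g ⌝ ∣ r° A
      -- The corner is padded to three rows matching `f`, the send and `g`, so that interchange
      -- brings it beside the send alone.
      ∼⟨ ∣-cong ∼-refl (∼-trans (/-identityʳ _) (/-identityˡ _)) ⟨
    ⌜ f ⌝ / sendᶜ _ A / ⌜ g ⌝ ∣ idᴴ unit / r° A / idᴴ A
      ∼⟨ ∼-trans (interchange _ _ _ _) (/-congˡ (interchange _ _ _ _)) ⟩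
    (⌜ f ⌝ ∣ idᴴ unit) / (sendᶜ _ A ∣ r° A) / (⌜ g ⌝ ∣ idᴴ A)
      ∼⟨ /-cong (/-cong (∣-idᴴ-unit _) (sendᶜ-∣-r° _ A)) (∼-sym (⌜⊗ʳ⌝ g)) ⟩
    ⌜ f ⌝ / idᴴ _ / ⌜ g ⊗ʳ A ⌝
      ∼⟨ /-congˡ (/-identityʳ _) ⟩
    ⌜ f ⌝ / ⌜ g ⊗ʳ A ⌝
      ∼⟨ ⌜⌝-⨾ _ _ ⟩
    ⌜ f ⨾ g ⊗ʳ A ⌝
      ∼⟨ ⌜cast⌝ _ _ _ ⟨
    ⌜ cast ρ refl (f ⨾ g ⊗ʳ A) ⌝
      ∎
  ⌈⌉-∣ (recv (ret f)) (s• A) =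
    recvᶜ _ A / ⌜ f ⌝ ∣ s• A                ∼⟨ ∣-cong ∼-refl (/-identityʳ _) ⟨
    recvᶜ _ A / ⌜ f ⌝ ∣ s• A / idᴴ unit     ∼⟨ interchange _ _ _ _ ⟩
    (recvᶜ _ A ∣ s• A) / (⌜ f ⌝ ∣ idᴴ unit) ∼⟨ /-cong (recvᶜ-∣-s• _ A) (∣-idᴴ-unit _) ⟩
    idᴴ _ / ⌜ f ⌝                           ∼⟨ /-identityˡ _ ⟩
    ⌜ f ⌝                                   ∼⟨ ⌜cast⌝ _ _ f ⟨
    ⌜ cast refl ρ f ⌝                       ∎
  ⌈⌉-∣ (ret f) (r• A) =
    ⌜ f ⌝ ∣ r• A                            ∼⟨ ∣-cong (⌜cast⌝ _ _ f) ∼-refl ⟨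
    ⌜ cast ρ refl f ⌝ ∣ r• A                ∼⟨ recvᶜ-⊗ʳ _ ⟨
    recvᶜ _ A / ⌜ cast ρ refl f ⊗ʳ A ⌝      ∎
  ⌈⌉-∣ (ret f) ⌜ g ⌝ = ⌜⌝-⊗ f g

  -- Evaluation of cells with trivial sides

  collapse : Cell A B [] [] → Hom A B
  collapse α = cast (⊗₀.identityˡ _) (⊗₀.identityˡ _) (value (act ⟦ α ⟧ (ret (𝟙 unit))))

  collapse-≋ : (α : Cell A B [] []) → collapse α ≋ value (act ⟦ α ⟧ (ret (𝟙 unit)))
  collapse-≋ α = cast-≋ _ _ _

  collapse-cong : {α β : Cell A B [] []} → α ∼ β → collapse α ≈ collapse β
  collapse-cong {α = α} {β} p = ≋⇒≈ (≋-trans (collapse-≋ α)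
    (≋-trans (≈⇒≋ (value-cong (≋ᴮ⇒≈ᴮ (sound p ≋ᴮ-refl)))) (≋-sym (collapse-≋ β))))

  collapse-⌜⌝ : (f : Hom A B) → collapse ⌜ f ⌝ ≈ f
  collapse-⌜⌝ f = ≋⇒≈ (≋-trans (collapse-≋ ⌜ f ⌝) (⊗₁-identityˡ f))

  -- Cutting along the empty boundary computes: `ret (𝟙 unit)` splits into two copies of itself, so
  -- each factor acts on the very input used by `collapse`.
  collapse-/ : (α : Cell A B [] []) (β : Cell B C [] []) →
               collapse (α / β) ≈ collapse α ⨾ collapse β
  collapse-/ α β = ≋⇒≈ (≋-trans (collapse-≋ (α / β)) (≋-trans
    (≈⇒≋ (value-⊙ (act ⟦ α ⟧ _) (act ⟦ β ⟧ _)))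
    (⨾-cong-≋ (≋-sym (collapse-≋ α)) (≋-sym (collapse-≋ β)))))

  ⌈⌉-value : (n : Behaviour C E []) → ⌈ n ⌉ ∼ ⌜ value n ⌝
  ⌈⌉-value (ret f) = ∼-refl

  -- The input `ret (𝟙 unit)` reifies to a unit for `_∣_`, so `⌈⌉-∣` at this input returns `α`
  -- itself.
  ⌜collapse⌝ : (α : Cell A B [] []) → ⌜ collapse α ⌝ ∼ α
  ⌜collapse⌝ α =
    ⌜ collapse α ⌝                          ∼⟨ ⌜⌝-cong-≋ (collapse-≋ α) ⟩
    ⌜ value (act ⟦ α ⟧ (ret (𝟙 unit))) ⌝    ∼⟨ ⌈⌉-value _ ⟨
    ⌈ act ⟦ α ⟧ (ret (𝟙 unit)) ⌉            ∼⟨ ⌈⌉-∣ (ret (𝟙 unit)) α ⟨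
    ⌜ 𝟙 unit ⌝ ∣ α                          ∼⟨ ∣-cong (∼-trans (⌜⌝-id unit) idᴴ∼idⱽ) ∼-refl ⟩
    idⱽ [] ∣ α                              ∼⟨ ∣-identityˡ α ⟩
    α                                       ∎

proposition4p4 : ∀ {o ℓ e} (𝔸 : SymmetricStrictMonoidalCategory o ℓ e) →
    IsomorphismOfCategories
    (StrictMonoidalCategory.category (𝐕 (𝒞 𝔸)))
    (SymmetricStrictMonoidalCategory.category 𝔸)
proposition4p4 𝔸 = record
  { to = record
    { F₀           = λ A → A
    ; F₁           = collapse
    ; F-cong       = collapse-cong
    ; identity     = λ A → ≈.trans (collapse-cong (∼-sym (⌜⌝-id A))) (collapse-⌜⌝ (𝟙 A))
    ; homomorphism = collapse-/
    }
  ; from = record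
    { F₀           = λ A → A
    ; F₁           = ⌜_⌝
    ; F-cong       = ⌜⌝-cong
    ; identity     = ⌜⌝-id
    ; homomorphism = λ f g → ∼-sym (⌜⌝-⨾ f g)
    }
  ; from∘to = record
    { eq₀ = λ _ → refl
    ; eq₁ = λ α → refl , refl , ⌜collapse⌝ α
    }
  ; to∘from = record
    { eq₀ = λ _ → refl
    ; eq₁ = λ f → refl , refl , collapse-⌜⌝ f
    }
  }
  where
  open FreeCornering 𝔸 using (⌜_⌝; ∼-sym; ⌜⌝-cong; ⌜⌝-id; ⌜⌝-⨾)
  open SymmetricStrictMonoidalCategory 𝔸 using () renaming (id to 𝟙)
  open CellNormalisation 𝔸 using
    (module ≈; collapse; collapse-cong; collapse-⌜⌝; collapse-/; ⌜collapse⌝)
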